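{- Let $s_1<\cdots<s_n$ be arbitrary positive integers ($n\ge 1$). Let $v_1,\dots,v_{s_n}$ be the columns of a real matrix $A=(a_{ij})_{1\le i\le n,\,1\le j\le s_n}$, where the $a_{ij}$'s with $1\le i\le n$ and $1\le j\le s_i$ are generic, and the remaining $a_{ij}$'s are equal to $0$. Then the vector matroid of $v_1,\dots,v_{s_n}$ is isomorphic to the shifted matroid $\mathbf{SM}(s_1,\dots,s_n)$.
   Context: Generic: given real numbers $x_1,\dots,x_k$, let $x_S=\prod_{i\in S}x_i$ for each $S\subseteq[k]=\{1,\dots,k\}$ (with $x_\emptyset=1$). Form all $2^{2^k}$ possible sums of some of the $x_S$'s, i.e. the sums $\sum_{S\in\mathcal{F}}x_S$ over all families $\mathcal{F}$ of subsets of $[k]$. The collection $x_1,\dots,x_k$ is called generic if these $2^{2^k}$ sums are all distinct. Here genericity refers to the whole collection of entries $a_{ij}$ with $1\le i\le n$, $1\le j\le s_i$. The vector matroid of an indexed family of vectors is the matroid on the index set whose independent sets are the index sets of linearly independent subfamilies. The shifted matroid $\mathbf{SM}(s_1,\dots,s_n)$ is the matroid on the ground set $[s_n]$ whose bases are the sets $\{a_1<\cdots<a_n\}$ of positive integers with $a_i\le s_i$ for all $1\le i\le n$. -}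

module Defs where

open import Algebra.Bundles using (CommutativeRing)
import Algebra.Properties.CommutativeMonoid.Sum as MonoidSum
import Algebra.Properties.Ring as RingProperties
import Algebra.Properties.Semiring.Sum as SemiringSum
open import Data.Bool.Base using (Bool; true; false; if_then_else_)
open import Data.Fin.Base as Fin using (Fin; zero; suc; toℕ; fromℕ; fromℕ<; punchIn)
open import Data.Fin.Permutation using (Permutation; _⟨$⟩ˡ_)
import Data.Fin.Properties as Fin
open import Data.Fin.Subset using (Subset; inside; outside; _∈_; _∉_; _⊆_; _∪_; ⁅_⁆; ⊥; ∣_∣)
import Data.Fin.Subset.Properties as Subset
open import Data.Nat.Base as ℕ using (ℕ; zero; suc; z≤n; s≤s; _∸_; _≤_; _<_)
import Data.Nat.Properties as ℕ
open import Data.Product.Base using (Σ; ∃; ∃₂; _×_; _,_; proj₁; proj₂)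
open import Data.Rational.Base as ℚ using (ℚ; 0ℚ; 1ℚ; ½)
import Data.Rational.Properties as ℚ
open import Data.Rational.Solver using (module +-*-Solver)
open import Data.Sum.Base using (_⊎_; inj₁; inj₂; [_,_]′)
open import Data.Vec.Base using ([]; _∷_; lookup; tabulate; here; there)
import Data.Vec.Properties as Vec
open import Data.Vec.Functional using (Vector; insertAt; removeAt; transpose)
import Data.Vec.Functional.Properties as Vector
open import Function.Base using (_∘_; _$_)
open import Function.Bundles using (_⇔_; mk⇔; _↔_; module Equivalence; module Inverse)
open import Function.Definitions using (Injective)
open import Level using (0ℓ; _⊔_)
open import Relation.Binary.Core using (_Preserves_⟶_)
open import Relation.Binary.Definitions using (tri<; tri≈; tri>)
open import Relation.Binary.PropositionalEquality.Core as ≡ using (_≡_; _≢_; refl)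
open import Relation.Nullary.Decidable using (dec-true)
open import Relation.Nullary.Decidable.Core using (yes; no; does)
open import Relation.Nullary.Negation.Core using (¬_; contradiction)

module Reals where

  module ℚ-Identities where

    open +-*-Solver

    split : ∀ a b → a ≡ b ℚ.+ (a ℚ.- b)
    split = solve 2 (λ a b → a := b :+ (a :- b)) refl

    neg-diff : ∀ a b → ℚ.- (a ℚ.- b) ≡ ℚ.- a ℚ.- ℚ.- b
    neg-diff = solve 2 (λ a b → :- (a :- b) := (:- a) :- (:- b)) refl

    swap-diff : ∀ a b → ℚ.- (a ℚ.- b) ≡ b ℚ.- a
    swap-diff = solve 2 (λ a b → :- (a :- b) := b :- a) refl

    tele : ∀ a b c → (a ℚ.- b) ℚ.+ (b ℚ.- c) ≡ a ℚ.- c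
    tele = solve 3 (λ a b c → (a :- b) :+ (b :- c) := a :- c) refl

    cancel : ∀ a b → a ℚ.+ b ℚ.- b ≡ a
    cancel = solve 2 (λ a b → a :+ b :- b := a) refl

    sum-diff : ∀ a b c d → (a ℚ.- b) ℚ.+ (c ℚ.- d) ≡ (a ℚ.+ c) ℚ.- (b ℚ.+ d)
    sum-diff = solve 4 (λ a b c d → (a :- b) :+ (c :- d) := (a :+ c) :- (b :+ d)) refl

    product-diff : ∀ a b c d → a ℚ.* (c ℚ.- d) ℚ.+ d ℚ.* (a ℚ.- b) ≡ a ℚ.* c ℚ.- b ℚ.* d
    product-diff = solve 4 (λ a b c d → a :* (c :- d) :+ d :* (a :- b) := (a :* c) :- (b :* d)) refl

  open ℚ-Identities

  -- Real numbers are Cauchy sequences of rationals, with equality _≈_ (the difference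
  -- tends to 0) instead of a quotient.

  IsCauchy : (ℕ → ℚ) → Set
  IsCauchy x = ∀ ε → 0ℚ ℚ.< ε →
               ∃ λ N → ∀ m n → N ℕ.≤ m → N ℕ.≤ n → ℚ.∣ x m ℚ.- x n ∣ ℚ.< ε

  record ℝ : Set where
    constructor mkℝ
    field
      seq      : ℕ → ℚ
      isCauchy : IsCauchy seq

  open ℝ

  infix 4 _≈_

  _≈_ : ℝ → ℝ → Set
  x ≈ y = ∀ ε → 0ℚ ℚ.< ε → ∃ λ N → ∀ n → N ℕ.≤ n → ℚ.∣ seq x n ℚ.- seq y n ∣ ℚ.< ε

  half>0 : ∀ {ε} → 0ℚ ℚ.< ε → 0ℚ ℚ.< ½ ℚ.* ε
  half>0 {ε} ε>0 = ℚ.*-monoʳ-<-pos ½ ε>0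

  half+half : ∀ ε → ½ ℚ.* ε ℚ.+ ½ ℚ.* ε ≡ ε
  half+half ε = ≡.trans (≡.sym (ℚ.*-distribʳ-+ ε ½ ½)) (ℚ.*-identityˡ ε)

  1>0 : 0ℚ ℚ.< 1ℚ
  1>0 = ℚ.positive⁻¹ 1ℚ

  ∣p∣+1>0 : ∀ p → 0ℚ ℚ.< ℚ.∣ p ∣ ℚ.+ 1ℚ
  ∣p∣+1>0 p = begin-strict
    0ℚ              <⟨ 1>0 ⟩
    1ℚ              ≡⟨ ℚ.+-identityˡ 1ℚ ⟨
    0ℚ ℚ.+ 1ℚ       ≤⟨ ℚ.+-monoˡ-≤ 1ℚ (ℚ.0≤∣p∣ p) ⟩
    ℚ.∣ p ∣ ℚ.+ 1ℚ  ∎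
    where open ℚ.≤-Reasoning

  near-bound : ∀ p q → ℚ.∣ p ℚ.- q ∣ ℚ.< 1ℚ → ℚ.∣ p ∣ ℚ.≤ ℚ.∣ q ∣ ℚ.+ 1ℚ
  near-bound p q lt = begin
    ℚ.∣ p ∣                    ≡⟨ ≡.cong ℚ.∣_∣ (split p q) ⟩
    ℚ.∣ q ℚ.+ (p ℚ.- q) ∣      ≤⟨ ℚ.∣p+q∣≤∣p∣+∣q∣ q (p ℚ.- q) ⟩
    ℚ.∣ q ∣ ℚ.+ ℚ.∣ p ℚ.- q ∣  ≤⟨ ℚ.+-monoʳ-≤ ℚ.∣ q ∣ (ℚ.<⇒≤ lt) ⟩
    ℚ.∣ q ∣ ℚ.+ 1ℚ             ∎
    where open ℚ.≤-Reasoning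

  -- Functions that become arbitrarily small along the sets  At N ⊇ At (suc N) ⊇ …
  module Smallness {I : Set} (At : ℕ → I → Set)
                   (anti : ∀ {M N i} → M ℕ.≤ N → At N i → At M i) where

    Small Bounded : (I → ℚ) → Set
    Small f   = ∀ ε → 0ℚ ℚ.< ε → ∃ λ N → ∀ i → At N i → ℚ.∣ f i ∣ ℚ.< ε
    Bounded f = ∃ λ K → 0ℚ ℚ.< K × ∃ λ N → ∀ i → At N i → ℚ.∣ f i ∣ ℚ.≤ K

    small-resp : ∀ {f g} → (∀ i → f i ≡ g i) → Small f → Small g
    small-resp eq sf ε ε>0 = let (N , b) = sf ε ε>0 in
      N , λ i a → ≡.subst (λ z → ℚ.∣ z ∣ ℚ.< ε) (eq i) (b i a)

    small-0 : ∀ {f} → (∀ i → f i ≡ 0ℚ) → Small f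
    small-0 eq ε ε>0 = 0 , λ i _ → ≡.subst (λ z → ℚ.∣ z ∣ ℚ.< ε) (≡.sym (eq i)) ε>0

    small-neg : ∀ {f} → Small f → Small (λ i → ℚ.- f i)
    small-neg {f} sf ε ε>0 = let (N , b) = sf ε ε>0 in
      N , λ i a → ≡.subst (ℚ._< ε) (≡.sym (ℚ.∣-p∣≡∣p∣ (f i))) (b i a)

    small-+ : ∀ {f g} → Small f → Small g → Small (λ i → f i ℚ.+ g i)
    small-+ {f} {g} sf sg ε ε>0 =
      let (M , b) = sf (½ ℚ.* ε) (half>0 ε>0)
          (N , c) = sg (½ ℚ.* ε) (half>0 ε>0) in
      M ℕ.⊔ N , λ i a → begin-strict
        ℚ.∣ f i ℚ.+ g i ∣        ≤⟨ ℚ.∣p+q∣≤∣p∣+∣q∣ (f i) (g i) ⟩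
        ℚ.∣ f i ∣ ℚ.+ ℚ.∣ g i ∣  <⟨ ℚ.+-mono-< (b i (anti (ℕ.m≤m⊔n M N) a))
                                           (c i (anti (ℕ.m≤n⊔m M N) a)) ⟩
        ½ ℚ.* ε ℚ.+ ½ ℚ.* ε      ≡⟨ half+half ε ⟩
        ε                        ∎
      where open ℚ.≤-Reasoning

    small-* : ∀ {f g} → Bounded f → Small g → Small (λ i → f i ℚ.* g i)
    small-* {f} {g} (K , K>0 , M , b) sg ε ε>0 = go
      where
      open ℚ.≤-Reasoning
      instance
        K⁺ : ℚ.Positive K
        K⁺ = ℚ.positive K>0
        K≢0 : ℚ.NonZero K
        K≢0 = ℚ.pos⇒nonZero K
        K≥0 : ℚ.NonNegative K
        K≥0 = ℚ.pos⇒nonNeg K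
        1/K⁺ : ℚ.Positive (ℚ.1/ K)
        1/K⁺ = ℚ.1/pos⇒pos K
      δ = ℚ.1/ K ℚ.* ε
      δ>0 : 0ℚ ℚ.< δ
      δ>0 = ≡.subst (ℚ._< δ) (ℚ.*-zeroʳ (ℚ.1/ K)) (ℚ.*-monoʳ-<-pos (ℚ.1/ K) ε>0)
      go : ∃ λ N → ∀ i → At N i → ℚ.∣ f i ℚ.* g i ∣ ℚ.< ε
      go = let (N , c) = sg δ δ>0 in M ℕ.⊔ N , λ i a → begin-strict
        ℚ.∣ f i ℚ.* g i ∣        ≡⟨ ℚ.∣p*q∣≡∣p∣*∣q∣ (f i) (g i) ⟩
        ℚ.∣ f i ∣ ℚ.* ℚ.∣ g i ∣  ≤⟨ ℚ.*-monoʳ-≤-nonNeg ℚ.∣ g i ∣ {{ℚ.∣-∣-nonNeg (g i)}}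
                                  (b i (anti (ℕ.m≤m⊔n M N) a)) ⟩
        K ℚ.* ℚ.∣ g i ∣          <⟨ ℚ.*-monoʳ-<-pos K (c i (anti (ℕ.m≤n⊔m M N) a)) ⟩
        K ℚ.* δ                  ≡⟨ ℚ.*-assoc K (ℚ.1/ K) ε ⟨
        K ℚ.* ℚ.1/ K ℚ.* ε       ≡⟨ ≡.cong (ℚ._* ε) (ℚ.*-inverseʳ K) ⟩
        1ℚ ℚ.* ε                 ≡⟨ ℚ.*-identityˡ ε ⟩
        ε                        ∎

  module S₁ = Smallness {ℕ} ℕ._≤_ ℕ.≤-trans
  module S₂ = Smallness {ℕ × ℕ} (λ N (m , n) → N ℕ.≤ m × N ℕ.≤ n)
                        (λ le (p , q) → ℕ.≤-trans le p , ℕ.≤-trans le q)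

  diff₂ : (ℕ → ℚ) → ℕ × ℕ → ℚ
  diff₂ x (m , n) = x m ℚ.- x n

  fromSmall₂ : ∀ x → S₂.Small (diff₂ x) → IsCauchy x
  fromSmall₂ x s ε ε>0 = let (N , b) = s ε ε>0 in N , λ m n p q → b (m , n) (p , q)

  small₂ : ∀ x → S₂.Small (diff₂ (seq x))
  small₂ x ε ε>0 = let (N , b) = isCauchy x ε ε>0 in N , λ (m , n) (p , q) → b m n p q

  bounded₁ : ∀ x → S₁.Bounded (seq x)
  bounded₁ x = let (N , b) = isCauchy x 1ℚ 1>0 in
    ℚ.∣ seq x N ∣ ℚ.+ 1ℚ , ∣p∣+1>0 (seq x N) ,
    N , λ n N≤n → near-bound (seq x n) (seq x N) (b n N N≤n ℕ.≤-refl)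

  bounded₂ˡ : ∀ x → S₂.Bounded (seq x ∘ proj₁)
  bounded₂ˡ x = let (K , K>0 , N , b) = bounded₁ x in K , K>0 , N , λ (m , n) (p , q) → b m p

  bounded₂ʳ : ∀ x → S₂.Bounded (seq x ∘ proj₂)
  bounded₂ʳ x = let (K , K>0 , N , b) = bounded₁ x in K , K>0 , N , λ (m , n) (p , q) → b n q

  abstract

    const-isCauchy : ∀ p → IsCauchy (λ _ → p)
    const-isCauchy p = fromSmall₂ (λ _ → p) (S₂.small-0 (λ _ → ℚ.+-inverseʳ p))

    +-isCauchy : ∀ x y → IsCauchy (λ n → seq x n ℚ.+ seq y n)
    +-isCauchy x y = fromSmall₂ (λ n → seq x n ℚ.+ seq y n) $ S₂.small-resp
      (λ (m , n) → sum-diff (seq x m) (seq x n) (seq y m) (seq y n))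
      (S₂.small-+ (small₂ x) (small₂ y))

    neg-isCauchy : ∀ x → IsCauchy (λ n → ℚ.- seq x n)
    neg-isCauchy x = fromSmall₂ (λ n → ℚ.- seq x n) $ S₂.small-resp
      (λ (m , n) → neg-diff (seq x m) (seq x n)) (S₂.small-neg (small₂ x))

    *-isCauchy : ∀ x y → IsCauchy (λ n → seq x n ℚ.* seq y n)
    *-isCauchy x y = fromSmall₂ (λ n → seq x n ℚ.* seq y n) $ S₂.small-resp
      (λ (m , n) → product-diff (seq x m) (seq x n) (seq y m) (seq y n))
      (S₂.small-+ (S₂.small-* (bounded₂ˡ x) (small₂ y)) (S₂.small-* (bounded₂ʳ y) (small₂ x)))

  infixl 6 _+_
  infixl 7 _*_
  infix  8 -_

  fromℚ : ℚ → ℝ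
  fromℚ p = mkℝ (λ _ → p) (const-isCauchy p)

  0ℝ 1ℝ : ℝ
  0ℝ = fromℚ 0ℚ
  1ℝ = fromℚ 1ℚ

  _+_ : ℝ → ℝ → ℝ
  x + y = mkℝ (λ n → seq x n ℚ.+ seq y n) (+-isCauchy x y)

  -_ : ℝ → ℝ
  - x = mkℝ (λ n → ℚ.- seq x n) (neg-isCauchy x)

  _*_ : ℝ → ℝ → ℝ
  x * y = mkℝ (λ n → seq x n ℚ.* seq y n) (*-isCauchy x y)

  abstract

    ≈-pointwise : ∀ x y → (∀ n → seq x n ≡ seq y n) → x ≈ y
    ≈-pointwise x y eq = S₁.small-0 λ n →
      ≡.trans (≡.cong (ℚ._- seq y n) (eq n)) (ℚ.+-inverseʳ (seq y n))

    ≈-sym : ∀ x y → x ≈ y → y ≈ x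
    ≈-sym x y e = S₁.small-resp (λ n → swap-diff (seq x n) (seq y n)) (S₁.small-neg e)

    ≈-trans : ∀ x y z → x ≈ y → y ≈ z → x ≈ z
    ≈-trans x y z e f =
      S₁.small-resp (λ n → tele (seq x n) (seq y n) (seq z n)) (S₁.small-+ e f)

    +-cong : ∀ x y u v → x ≈ y → u ≈ v → x + u ≈ y + v
    +-cong x y u v e f = S₁.small-resp
      (λ n → sum-diff (seq x n) (seq y n) (seq u n) (seq v n)) (S₁.small-+ e f)

    -‿cong : ∀ x y → x ≈ y → - x ≈ - y
    -‿cong x y e = S₁.small-resp (λ n → neg-diff (seq x n) (seq y n)) (S₁.small-neg e)

    *-cong : ∀ x y u v → x ≈ y → u ≈ v → x * u ≈ y * v
    *-cong x y u v e f = S₁.small-resp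
      (λ n → product-diff (seq x n) (seq y n) (seq u n) (seq v n))
      (S₁.small-+ (S₁.small-* (bounded₁ x) f) (S₁.small-* (bounded₁ v) e))

  ℝ-commutativeRing : CommutativeRing 0ℓ 0ℓ
  ℝ-commutativeRing = record
    { Carrier = ℝ ; _≈_ = _≈_ ; _+_ = _+_ ; _*_ = _*_ ; -_ = -_
    ; 0# = 0ℝ ; 1# = 1ℝ
    ; isCommutativeRing = record
      { isRing = record
        { +-isAbelianGroup = record
          { isGroup = record
            { isMonoid = record
              { isSemigroup = record
                { isMagma = record
                  { isEquivalence = record
                    { refl  = λ {x} → ≈-pointwise x x λ _ → refl
                    ; sym   = λ {x} {y} → ≈-sym x y
                    ; trans = λ {x} {y} {z} → ≈-trans x y z
                    }
                  ; ∙-cong = λ {x} {y} {u} {v} → +-cong x y u v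
                  }
                ; assoc = λ x y z → ≈-pointwise (x + y + z) (x + (y + z)) λ n → ℚ.+-assoc (seq x n) (seq y n) (seq z n)
                }
              ; identity = (λ x → ≈-pointwise (0ℝ + x) x λ n → ℚ.+-identityˡ (seq x n))
                         , (λ x → ≈-pointwise (x + 0ℝ) x λ n → ℚ.+-identityʳ (seq x n))
              }
            ; inverse = (λ x → ≈-pointwise (- x + x) 0ℝ λ n → ℚ.+-inverseˡ (seq x n))
                      , (λ x → ≈-pointwise (x + - x) 0ℝ λ n → ℚ.+-inverseʳ (seq x n))
            ; ⁻¹-cong = λ {x} {y} → -‿cong x y
            }
          ; comm = λ x y → ≈-pointwise (x + y) (y + x) λ n → ℚ.+-comm (seq x n) (seq y n)
          }
        ; *-cong = λ {x} {y} {u} {v} → *-cong x y u v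
        ; *-assoc = λ x y z → ≈-pointwise (x * y * z) (x * (y * z)) λ n → ℚ.*-assoc (seq x n) (seq y n) (seq z n)
        ; *-identity = (λ x → ≈-pointwise (1ℝ * x) x λ n → ℚ.*-identityˡ (seq x n))
                     , (λ x → ≈-pointwise (x * 1ℝ) x λ n → ℚ.*-identityʳ (seq x n))
        ; distrib = (λ x y z → ≈-pointwise (x * (y + z)) (x * y + x * z) λ n → ℚ.*-distribˡ-+ (seq x n) (seq y n) (seq z n))
                  , (λ x y z → ≈-pointwise ((y + z) * x) (y * x + z * x) λ n → ℚ.*-distribʳ-+ (seq x n) (seq y n) (seq z n))
        }
      ; *-comm = λ x y → ≈-pointwise (x * y) (y * x) λ n → ℚ.*-comm (seq x n) (seq y n)
      }
    }

  AwayFrom0 : ℝ → Set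
  AwayFrom0 x = ∃ λ δ → 0ℚ ℚ.< δ × ∃ λ N → ∀ n → N ℕ.≤ n → δ ℚ.≤ ℚ.∣ seq x n ∣

  ¬away⇒≈0 : ∀ x → ¬ AwayFrom0 x → x ≈ 0ℝ
  ¬away⇒≈0 x ¬a ε ε>0 = go
    where
    open ℚ.≤-Reasoning
    y = seq x
    η = ½ ℚ.* (½ ℚ.* ε)
    go : ∃ λ N → ∀ n → N ℕ.≤ n → ℚ.∣ y n ℚ.- 0ℚ ∣ ℚ.< ε
    N = proj₁ (isCauchy x η (half>0 (half>0 ε>0)))
    b = proj₂ (isCauchy x η (half>0 (half>0 ε>0)))
    go with ℚ.∣ y N ∣ ℚ.<? ½ ℚ.* ε
    ... | yes lt = N , λ n N≤n → begin-strict
      ℚ.∣ y n ℚ.- 0ℚ ∣                 ≡⟨ ≡.cong ℚ.∣_∣ (≡.trans (ℚ.+-identityʳ (y n)) (split (y n) (y N))) ⟩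
      ℚ.∣ y N ℚ.+ (y n ℚ.- y N) ∣      ≤⟨ ℚ.∣p+q∣≤∣p∣+∣q∣ (y N) (y n ℚ.- y N) ⟩
      ℚ.∣ y N ∣ ℚ.+ ℚ.∣ y n ℚ.- y N ∣  <⟨ ℚ.+-mono-< lt (ℚ.<-trans (b n N N≤n ℕ.≤-refl) η<½ε) ⟩
      ½ ℚ.* ε ℚ.+ ½ ℚ.* ε              ≡⟨ half+half ε ⟩
      ε                                ∎
      where
      η<½ε : η ℚ.< ½ ℚ.* ε
      η<½ε = begin-strict
        η         ≡⟨ ℚ.+-identityʳ η ⟨
        η ℚ.+ 0ℚ  <⟨ ℚ.+-monoʳ-< η (half>0 (half>0 ε>0)) ⟩
        η ℚ.+ η   ≡⟨ half+half (½ ℚ.* ε) ⟩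
        ½ ℚ.* ε   ∎
    ... | no ge = contradiction
      (η , half>0 (half>0 ε>0) , N , λ n N≤n → begin
        η                                      ≡⟨ cancel η η ⟨
        (η ℚ.+ η) ℚ.- η                        ≡⟨ ≡.cong (ℚ._- η) (half+half (½ ℚ.* ε)) ⟩
        ½ ℚ.* ε ℚ.- η                          ≤⟨ ℚ.+-monoˡ-≤ (ℚ.- η) (ℚ.≮⇒≥ ge) ⟩
        ℚ.∣ y N ∣ ℚ.- η                        ≡⟨ ≡.cong (λ z → ℚ.∣ z ∣ ℚ.- η) (split (y N) (y n)) ⟩
        ℚ.∣ y n ℚ.+ (y N ℚ.- y n) ∣ ℚ.- η      ≤⟨ ℚ.+-monoˡ-≤ (ℚ.- η) (ℚ.∣p+q∣≤∣p∣+∣q∣ (y n) (y N ℚ.- y n)) ⟩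
        ℚ.∣ y n ∣ ℚ.+ ℚ.∣ y N ℚ.- y n ∣ ℚ.- η  ≤⟨ ℚ.+-monoˡ-≤ (ℚ.- η) (ℚ.+-monoʳ-≤ ℚ.∣ y n ∣ (ℚ.<⇒≤ (b N n ℕ.≤-refl N≤n))) ⟩
        ℚ.∣ y n ∣ ℚ.+ η ℚ.- η                  ≡⟨ cancel ℚ.∣ y n ∣ η ⟩
        ℚ.∣ y n ∣                              ∎)
      ¬a

  away⇒≉0 : ∀ x → AwayFrom0 x → ¬ x ≈ 0ℝ
  away⇒≉0 x (δ , δ>0 , N , b) e =
    ℚ.<-irrefl refl (ℚ.≤-<-trans (b n (ℕ.m≤m⊔n N M))
      (≡.subst (λ z → ℚ.∣ z ∣ ℚ.< δ) (ℚ.+-identityʳ (seq x n)) (c n (ℕ.m≤n⊔m N M))))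
    where
    M = proj₁ (e δ δ>0)
    c = proj₂ (e δ δ>0)
    n = N ℕ.⊔ M

  away-* : ∀ x y → AwayFrom0 x → AwayFrom0 y → AwayFrom0 (x * y)
  away-* x y (δ , δ>0 , M , b) (η , η>0 , N , c) =
    δ ℚ.* η ,
    ≡.subst (ℚ._< δ ℚ.* η) (ℚ.*-zeroʳ δ) (ℚ.*-monoʳ-<-pos δ {{ℚ.positive δ>0}} η>0) ,
    M ℕ.⊔ N , λ n le → begin
      δ ℚ.* η                          ≤⟨ ℚ.*-monoˡ-≤-nonNeg δ {{ℚ.nonNegative (ℚ.<⇒≤ δ>0)}} (c n (ℕ.m⊔n≤o⇒n≤o M N le)) ⟩
      δ ℚ.* ℚ.∣ seq y n ∣              ≤⟨ ℚ.*-monoʳ-≤-nonNeg ℚ.∣ seq y n ∣ {{ℚ.∣-∣-nonNeg (seq y n)}} (b n (ℕ.m⊔n≤o⇒m≤o M N le)) ⟩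
      ℚ.∣ seq x n ∣ ℚ.* ℚ.∣ seq y n ∣  ≡⟨ ℚ.∣p*q∣≡∣p∣*∣q∣ (seq x n) (seq y n) ⟨
      ℚ.∣ seq x n ℚ.* seq y n ∣        ∎
    where open ℚ.≤-Reasoning

  abstract

    ≈0-stable : ∀ x → ¬ ¬ (x ≈ 0ℝ) → x ≈ 0ℝ
    ≈0-stable x ¬¬e = ¬away⇒≈0 x (λ a → ¬¬e (away⇒≉0 x a))

    ≈0-cancel : ∀ x y → ¬ (x ≈ 0ℝ) → x * y ≈ 0ℝ → y ≈ 0ℝ
    ≈0-cancel x y x≉0 e = ¬away⇒≈0 y λ ay → x≉0 (¬away⇒≈0 x λ ax → away⇒≉0 (x * y) (away-* x y ax ay) e)

    1≉0 : ¬ (1ℝ ≈ 0ℝ)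
    1≉0 = away⇒≉0 (1ℝ) (1ℚ , 1>0 , 0 , λ _ _ → ℚ.≤-refl)

-- The augmentation axiom asserts its existential classically (¬ ¬): linear independence
-- over ℝ is not decidable, and only this form of exchange holds for it constructively.

record Matroid (k : ℕ) : Set₁ where
  field
    Independent   : Subset k → Set
    ∅-independent : Independent ⊥
    ⊆-independent : ∀ {I J} → I ⊆ J → Independent J → Independent I
    augmentation  : ∀ {I J} → Independent I → Independent J → ∣ I ∣ ℕ.< ∣ J ∣ →
                    ¬ ¬ (∃ λ e → e ∈ J × e ∉ I × Independent (I ∪ ⁅ e ⁆))

open Matroid using (Independent)

Basis : ∀ {k} → Matroid k → Subset k → Set
Basis M B = Independent M B × (∀ {J} → Independent M J → B ⊆ J → J ⊆ B)

image : ∀ {k l} → Permutation k l → Subset k → Subset l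
image σ S = tabulate λ j → lookup S (σ ⟨$⟩ˡ j)

infix 4 _≅_

_≅_ : ∀ {k l} → Matroid k → Matroid l → Set
_≅_ {k} {l} M N = Σ (Permutation k l) λ σ →
  ∀ S → Independent M S ⇔ Independent N (image σ S)

module Enumeration where

  enum : ∀ {k} (S : Subset k) → Fin ∣ S ∣ → Fin k
  enum (inside  ∷ S) zero    = zero
  enum (inside  ∷ S) (suc i) = suc (enum S i)
  enum (outside ∷ S) i       = suc (enum S i)

  enum-∈ : ∀ {k} (S : Subset k) i → enum S i ∈ S
  enum-∈ (inside  ∷ S) zero    = here
  enum-∈ (inside  ∷ S) (suc i) = there (enum-∈ S i)
  enum-∈ (outside ∷ S) i       = there (enum-∈ S i)

  enum⁻¹ : ∀ {k} (S : Subset k) {j} → j ∈ S → ∃ λ i → enum S i ≡ j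
  enum⁻¹ (inside  ∷ S) here      = zero , refl
  enum⁻¹ (inside  ∷ S) (there p) = let (i , e) = enum⁻¹ S p in suc i , ≡.cong suc e
  enum⁻¹ (outside ∷ S) (there p) = let (i , e) = enum⁻¹ S p in i , ≡.cong suc e

  extend : ∀ {a} {A : Set a} {k} (S : Subset k) → (Fin ∣ S ∣ → A) → A → Fin k → A
  extend (inside  ∷ S) f a zero    = f zero
  extend (outside ∷ S) f a zero    = a
  extend (inside  ∷ S) f a (suc j) = extend S (f ∘ suc) a j
  extend (outside ∷ S) f a (suc j) = extend S f a j

  extend-enum : ∀ {a} {A : Set a} {k} (S : Subset k) (f : Fin ∣ S ∣ → A) a i →
                extend S f a (enum S i) ≡ f i
  extend-enum (inside  ∷ S) f a zero    = refl
  extend-enum (inside  ∷ S) f a (suc i) = extend-enum S (f ∘ suc) a i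
  extend-enum (outside ∷ S) f a i       = extend-enum S f a i

  ¬¬-∀ : ∀ {p k} {P : Fin k → Set p} → (∀ i → ¬ ¬ P i) → ¬ ¬ (∀ i → P i)
  ¬¬-∀ {k = zero}  h ¬p = ¬p λ ()
  ¬¬-∀ {k = suc k} h ¬p = h zero λ p₀ → ¬¬-∀ (h ∘ suc) λ p →
    ¬p λ { zero → p₀ ; (suc i) → p i }

open Enumeration

module LinearAlgebra {c ℓ} (R : CommutativeRing c ℓ) where

  open CommutativeRing R hiding (zero) renaming (refl to ≈-refl)
  private module ∏ = MonoidSum *-commutativeMonoid
  open SemiringSum semiring

  ∑∈ ∏∈ : ∀ {k} → Subset k → Vector Carrier k → Carrier
  ∑∈ S x = sum   λ i → if lookup S i then x i else 0#
  ∏∈ S x = ∏.sum λ i → if lookup S i then x i else 1#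

  -- The sum of f S over all 2 ^ k subsets S.
  ∑⊆ : ∀ {k} → (Subset k → Carrier) → Carrier
  ∑⊆ {zero}  f = f []
  ∑⊆ {suc k} f = ∑⊆ (f ∘ (inside ∷_)) + ∑⊆ (f ∘ (outside ∷_))

  -- F is the characteristic function of a family of subsets.
  familySum : ∀ {k} → Vector Carrier k → (Subset k → Bool) → Carrier
  familySum x F = ∑⊆ λ S → if F S then ∏∈ S x else 0#

  Generic : ∀ {k} → Vector Carrier k → Set ℓ
  Generic x = ∀ F G → (∃ λ S → F S ≢ G S) → ¬ (familySum x F ≈ familySum x G)

  -- A collection indexed by a finite set I is listed as x₁, …, x_k along a bijection;
  -- genericity does not depend on the choice of listing.
  GenericCollection : ∀ {i} {I : Set i} → (I → Carrier) → Set (i ⊔ ℓ)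
  GenericCollection {I = I} x =
    ∃₂ λ k (e : Fin k ↔ I) → Generic (x ∘ Inverse.to e)

  -- Of the subfamily (v j) for j ∈ S.
  LinearlyIndependent : ∀ {k n} → (Fin k → Vector Carrier n) → Subset k → Set (c ⊔ ℓ)
  LinearlyIndependent {k} v S = ∀ (c : Vector Carrier k) →
    (∀ i → ∑∈ S (λ j → c j * v j i) ≈ 0#) → ∀ j → j ∈ S → c j ≈ 0#

  module Domain
    (stable : ∀ x → ¬ ¬ (x ≈ 0#) → x ≈ 0#)
    (cancel : ∀ x y → ¬ (x ≈ 0#) → x * y ≈ 0# → y ≈ 0#)
    (1≉0    : ¬ (1# ≈ 0#))
    where

    open RingProperties ring
    open import Relation.Binary.Reasoning.Setoid setoid

    ∑-cong : ∀ {k} {f g : Vector Carrier k} → (∀ i → f i ≈ g i) → sum f ≈ sum g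
    ∑-cong = sum-cong-≋

    ∑-0 : ∀ {k} {f : Vector Carrier k} → (∀ i → f i ≈ 0#) → sum f ≈ 0#
    ∑-0 {k} e = trans (∑-cong e) (sum-replicate-zero k)

    ∑-neg : ∀ {m} (f : Vector Carrier m) → sum (λ l → - f l) ≈ - sum f
    ∑-neg f = begin
      sum (λ l → - f l)        ≈⟨ ∑-cong (λ l → -1*x≈-x (f l)) ⟨
      sum (λ l → - 1# * f l)   ≈⟨ *-distribˡ-sum (- 1#) f ⟨
      - 1# * sum f             ≈⟨ -1*x≈-x (sum f) ⟩
      - sum f                  ∎

    rearrange : ∀ p q r w x → p * (q * r - w * x) ≈ (q * p) * r + - (p * w) * x
    rearrange p q r w x = begin
      p * (q * r - w * x)             ≈⟨ distribˡ p (q * r) (- (w * x)) ⟩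
      p * (q * r) + p * - (w * x)     ≈⟨ +-cong (trans (sym (*-assoc p q r)) (*-congʳ (*-comm p q)))
                                                (sym (-‿distribʳ-* p (w * x))) ⟩
      (q * p) * r + - (p * (w * x))   ≈⟨ +-congˡ (-‿cong (sym (*-assoc p w x))) ⟩
      (q * p) * r + - (p * w * x)     ≈⟨ +-congˡ (-‿distribˡ-* (p * w) x) ⟩
      (q * p) * r + - (p * w) * x     ∎

    -- Eliminating the first coordinate from the vectors (q l , x l) by means of (p , y).
    module _ {k} (p : Carrier) (q : Fin k → Carrier) (d : Fin k → Carrier) where

      eliminate₀ : - sum (λ l → d l * q l) * p + sum (λ l → (p * d l) * q l) ≈ 0#
      eliminate₀ = begin
        - b * p + sum (λ l → (p * d l) * q l)
          ≈⟨ +-cong (sym (-‿distribˡ-* b p)) (∑-cong λ l → *-assoc p (d l) (q l)) ⟩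
        - (b * p) + sum (λ l → p * (d l * q l))
          ≈⟨ +-cong (-‿cong (*-comm b p)) (sym (*-distribˡ-sum p (λ l → d l * q l))) ⟩
        - (p * b) + p * b
          ≈⟨ -‿inverseˡ (p * b) ⟩
        0# ∎
        where b = sum λ l → d l * q l

      eliminate : ∀ (x : Fin k → Carrier) y → sum (λ l → d l * (p * x l - q l * y)) ≈ 0# →
                  - sum (λ l → d l * q l) * y + sum (λ l → (p * d l) * x l) ≈ 0#
      eliminate x y e = begin
        - sum (λ l → d l * q l) * y + sum (λ l → (p * d l) * x l)
          ≈⟨ +-comm _ _ ⟩
        sum (λ l → (p * d l) * x l) + - sum (λ l → d l * q l) * y
          ≈⟨ +-congˡ (*-congʳ (sym (∑-neg (λ l → d l * q l)))) ⟩
        sum (λ l → (p * d l) * x l) + sum (λ l → - (d l * q l)) * y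
          ≈⟨ +-congˡ (*-distribʳ-sum y (λ l → - (d l * q l))) ⟩
        sum (λ l → (p * d l) * x l) + sum (λ l → - (d l * q l) * y)
          ≈⟨ ∑-distrib-+ (λ l → (p * d l) * x l) (λ l → - (d l * q l) * y) ⟨
        sum (λ l → (p * d l) * x l + - (d l * q l) * y)
          ≈⟨ ∑-cong (λ l → rearrange (d l) p (x l) (q l) y) ⟨
        sum (λ l → d l * (p * x l - q l * y))
          ≈⟨ e ⟩
        0# ∎

    sum-insertAt : ∀ {k} (j : Fin (suc k)) (d : Fin k → Carrier) a (t : Fin (suc k) → Carrier) →
      sum (λ l → insertAt d j a l * t l) ≈ a * t j + sum (λ l → d l * t (punchIn j l))
    sum-insertAt j d a t = trans (sum-remove {i = j} (λ l → insertAt d j a l * t l)) (+-cong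
      (*-congʳ (reflexive (Vector.insertAt-lookup d j a)))
      (∑-cong λ l → *-congʳ (reflexive (Vector.insertAt-punchIn d j a l))))

    Dependent : ∀ {n k} → (Fin k → Vector Carrier n) → Set (c ⊔ ℓ)
    Dependent {k = k} t = ∃ λ (c : Vector Carrier k) → (∃ λ (j : Fin k) → ¬ (c j ≈ 0#)) × ∀ i → sum (λ j → c j * t j i) ≈ 0#

    dependent-step₀ : ∀ {n k} (t : Fin k → Fin (suc n) → Carrier) → (∀ j → t j zero ≈ 0#) →
                      Dependent (λ j → t j ∘ suc) → Dependent t
    dependent-step₀ t t₀≈0 (c , c≉0 , e) = c , c≉0 ,
      λ { zero → ∑-0 λ j → trans (*-congˡ (t₀≈0 j)) (zeroʳ (c j)) ; (suc i) → e i }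

    dependent-step : ∀ {n k} (t : Fin (suc k) → Fin (suc n) → Carrier) j → ¬ (t j zero ≈ 0#) →
      Dependent (λ l i → t j zero * t (punchIn j l) (suc i) - t (punchIn j l) zero * t j (suc i)) →
      Dependent t
    dependent-step t j p≉0 (d , (l , d≉0) , e) =
        insertAt pd j a
      , (punchIn j l , λ z → d≉0 (cancel p (d l) p≉0
          (trans (reflexive (≡.sym (Vector.insertAt-punchIn pd j a l))) z)))
      , λ { zero    → trans (sum-insertAt j pd a (λ l → t l zero)) (eliminate₀ p q d)
          ; (suc i) → trans (sum-insertAt j pd a (λ l → t l (suc i)))
                            (eliminate p q d (λ l → t (punchIn j l) (suc i)) (t j (suc i)) (e i)) }
      where
      p = t j zero
      q = λ l → t (punchIn j l) zero
      pd = λ l → p * d l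
      a = - sum (λ l → d l * q l)

    dependent : ∀ {n k} (t : Fin k → Fin n → Carrier) → n ℕ.< k → ¬ ¬ Dependent t
    dependent {zero}  {suc k} t _ ¬dep = ¬dep ((λ _ → 1#) , (zero , 1≉0) , λ ())
    dependent {suc n} {suc k} t (s≤s n<k) ¬dep =
      dependent (λ j → t j ∘ suc) (ℕ.m<n⇒m<1+n n<k) λ dep →
        ¬dep (dependent-step₀ t (λ j → stable (t j zero) λ p≉0 →
          dependent _ n<k λ dep′ → ¬dep (dependent-step t j p≉0 dep′)) dep)

    ∑∈-cong : ∀ {k} (S : Subset k) {f g} → (∀ j → j ∈ S → f j ≈ g j) → ∑∈ S f ≈ ∑∈ S g
    ∑∈-cong []            e = ≈-refl
    ∑∈-cong (inside  ∷ S) e = +-cong (e zero here) (∑∈-cong S λ j p → e (suc j) (there p))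
    ∑∈-cong (outside ∷ S) e = +-congˡ (∑∈-cong S λ j p → e (suc j) (there p))

    ∑∈-enum : ∀ {k} (S : Subset k) f → ∑∈ S f ≈ sum (f ∘ enum S)
    ∑∈-enum []            f = ≈-refl
    ∑∈-enum (inside  ∷ S) f = +-congˡ (∑∈-enum S (f ∘ suc))
    ∑∈-enum (outside ∷ S) f = trans (+-identityˡ _) (∑∈-enum S (f ∘ suc))

    ∑∈-∪⁅⁆ : ∀ {k} (S : Subset k) {e} → e ∉ S → ∀ f → ∑∈ (S ∪ ⁅ e ⁆) f ≈ f e + ∑∈ S f
    ∑∈-∪⁅⁆ (inside  ∷ S) {zero} e∉S f = contradiction here e∉S
    ∑∈-∪⁅⁆ (outside ∷ S) {zero} e∉S f =
      +-congˡ (trans (reflexive (≡.cong (λ T → ∑∈ T (f ∘ suc)) (Subset.∪-identityʳ S)))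
                     (sym (+-identityˡ _)))
    ∑∈-∪⁅⁆ (inside ∷ S) {suc e} e∉S f = begin
      f zero + ∑∈ (S ∪ ⁅ e ⁆) (f ∘ suc)          ≈⟨ +-congˡ (∑∈-∪⁅⁆ S (e∉S ∘ there) (f ∘ suc)) ⟩
      f zero + (f (suc e) + ∑∈ S (f ∘ suc))      ≈⟨ +-assoc _ _ _ ⟨
      f zero + f (suc e) + ∑∈ S (f ∘ suc)        ≈⟨ +-congʳ (+-comm _ _) ⟩
      f (suc e) + f zero + ∑∈ S (f ∘ suc)        ≈⟨ +-assoc _ _ _ ⟩
      f (suc e) + (f zero + ∑∈ S (f ∘ suc))      ∎
    ∑∈-∪⁅⁆ (outside ∷ S) {suc e} e∉S f = begin
      0# + ∑∈ (S ∪ ⁅ e ⁆) (f ∘ suc)              ≈⟨ +-identityˡ _ ⟩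
      ∑∈ (S ∪ ⁅ e ⁆) (f ∘ suc)                   ≈⟨ ∑∈-∪⁅⁆ S (e∉S ∘ there) (f ∘ suc) ⟩
      f (suc e) + ∑∈ S (f ∘ suc)                 ≈⟨ +-congˡ (+-identityˡ _) ⟨
      f (suc e) + (0# + ∑∈ S (f ∘ suc))          ∎

    ∑∈-neg : ∀ {k} (S : Subset k) f → ∑∈ S (λ j → - f j) ≈ - ∑∈ S f
    ∑∈-neg []            f = sym -0#≈0#
    ∑∈-neg (inside  ∷ S) f = trans (+-congˡ (∑∈-neg S (f ∘ suc))) (-‿+-comm _ _)
    ∑∈-neg (outside ∷ S) f =
      trans (+-identityˡ _) (trans (∑∈-neg S (f ∘ suc)) (-‿cong (sym (+-identityˡ _))))

    ∑∈-single : ∀ {k} (S : Subset k) {e} → e ∈ S → ∀ f → (∀ j → j ≢ e → f j ≈ 0#) → ∑∈ S f ≈ f e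
    ∑∈-single {suc _} S {e} e∈S f z = begin
      ∑∈ S f       ≈⟨ sum-remove {i = e} g ⟩
      g e + sum (removeAt g e)
                   ≈⟨ +-cong (reflexive (≡.cong (λ b → if b then f e else 0#) (Vec.[]=⇒lookup e∈S)))
                             (∑-0 λ l → vanish (punchIn e l) (Fin.punchInᵢ≢i e l)) ⟩
      f e + 0#     ≈⟨ +-identityʳ (f e) ⟩
      f e          ∎
      where
      g = λ i → if lookup S i then f i else 0#
      vanish : ∀ j → j ≢ e → g j ≈ 0#
      vanish j j≢e with lookup S j
      ... | true  = z j j≢e
      ... | false = ≈-refl

    module _ {k n} (v : Fin k → Vector Carrier n) where

      ∅-linearlyIndependent : LinearlyIndependent v ⊥
      ∅-linearlyIndependent c _ j j∈ = contradiction j∈ Subset.∉⊥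

      ⊆-linearlyIndependent : ∀ {I J} → I ⊆ J → LinearlyIndependent v J → LinearlyIndependent v I
      ⊆-linearlyIndependent {I} {J} I⊆J indJ c e j j∈I =
        trans (c≈c′ j j∈I) (indJ c′ (λ i → trans (∑-cong (same i)) (e i)) j (I⊆J j∈I))
        where
        c′ = λ j → if lookup I j then c j else 0#
        c≈c′ : ∀ j → j ∈ I → c j ≈ c′ j
        c≈c′ j j∈I = reflexive (≡.cong (λ b → if b then c j else 0#) (≡.sym (Vec.[]=⇒lookup j∈I)))
        same : ∀ i j → (if lookup J j then c′ j * v j i else 0#) ≈ (if lookup I j then c j * v j i else 0#)
        same i j with lookup I j in p | lookup J j in q
        ... | true  | true  = ≈-refl
        ... | true  | false = contradiction (≡.trans (≡.sym q) (Vec.[]=⇒lookup (I⊆J (Vec.lookup⇒[]= j I p)))) λ ()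
        ... | false | true  = zeroˡ (v j i)
        ... | false | false = ≈-refl

      Spanned : Subset k → Fin k → Set (c ⊔ ℓ)
      Spanned I e = ∃ λ d → ¬ (d ≈ 0#) × ∃ λ (t : Vector Carrier k) → ∀ i → d * v e i ≈ ∑∈ I (λ j → t j * v j i)

      ∈⇒spanned : ∀ {I e} → e ∈ I → Spanned I e
      ∈⇒spanned {I} {e} e∈I = 1# , 1≉0 , δ , λ i → sym (begin
        ∑∈ I (λ j → δ j * v j i)  ≈⟨ ∑∈-single I e∈I (λ j → δ j * v j i) (λ j j≢e → trans (*-congʳ (δ-≢ j j≢e)) (zeroˡ _)) ⟩
        δ e * v e i               ≈⟨ *-congʳ δ-≡ ⟩
        1# * v e i                ∎)
        where
        δ : Fin k → Carrier
        δ j = if does (j Fin.≟ e) then 1# else 0#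
        δ-≢ : ∀ j → j ≢ e → δ j ≈ 0#
        δ-≢ j j≢e with j Fin.≟ e
        ... | yes j≡e = contradiction j≡e j≢e
        ... | no  _   = ≈-refl
        δ-≡ : δ e ≈ 1#
        δ-≡ with e Fin.≟ e
        ... | yes _  = ≈-refl
        ... | no e≢e = contradiction refl e≢e

      dependent⇒spanned : ∀ {I e} → LinearlyIndependent v I → e ∉ I →
                          ¬ LinearlyIndependent v (I ∪ ⁅ e ⁆) → ¬ ¬ Spanned I e
      dependent⇒spanned {I} {e} indI e∉I dep ¬sp = dep ind
        where
        ind : LinearlyIndependent v (I ∪ ⁅ e ⁆)
        ind c r j j∈ = [ (λ j∈I → indI c r′ j j∈I)
                       , (λ j∈e → ≡.subst (λ j → c j ≈ 0#) (≡.sym (Subset.x∈⁅y⁆⇒x≡y e j∈e)) cₑ≈0)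
                       ]′ (Subset.x∈p∪q⁻ I ⁅ e ⁆ j∈)
          where
          r″ : ∀ i → c e * v e i + ∑∈ I (λ j → c j * v j i) ≈ 0#
          r″ i = trans (sym (∑∈-∪⁅⁆ I e∉I (λ j → c j * v j i))) (r i)
          cₑ≈0 : c e ≈ 0#
          cₑ≈0 = stable (c e) λ cₑ≉0 → ¬sp (c e , cₑ≉0 , (λ j → - c j) , λ i → begin
            c e * v e i                        ≈⟨ +-inverseˡ-unique _ _ (r″ i) ⟩
            - ∑∈ I (λ j → c j * v j i)         ≈⟨ ∑∈-neg I _ ⟨
            ∑∈ I (λ j → - (c j * v j i))       ≈⟨ ∑∈-cong I (λ j _ → -‿distribˡ-* _ _) ⟩
            ∑∈ I (λ j → - c j * v j i)         ∎)
          r′ : ∀ i → ∑∈ I (λ j → c j * v j i) ≈ 0#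
          r′ i = begin
            ∑∈ I (λ j → c j * v j i)                   ≈⟨ +-identityˡ _ ⟨
            0# + ∑∈ I (λ j → c j * v j i)              ≈⟨ +-congʳ (trans (*-congʳ cₑ≈0) (zeroˡ _)) ⟨
            c e * v e i + ∑∈ I (λ j → c j * v j i)     ≈⟨ r″ i ⟩
            0#                                         ∎

      augment-linearlyIndependent : ∀ {I J} → LinearlyIndependent v I → LinearlyIndependent v J →
        ∣ I ∣ ℕ.< ∣ J ∣ → ¬ ¬ (∃ λ e → e ∈ J × e ∉ I × LinearlyIndependent v (I ∪ ⁅ e ⁆))
      augment-linearlyIndependent {I} {J} indI indJ lt ¬aug = ¬¬-∀ spanned contra
        where
        spanned : ∀ l → ¬ ¬ Spanned I (enum J l)
        spanned l with enum J l Subset.∈? I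
        ... | yes e∈I = λ ¬sp → ¬sp (∈⇒spanned e∈I)
        ... | no  e∉I = dependent⇒spanned indI e∉I λ ind → ¬aug (enum J l , enum-∈ J l , e∉I , ind)

        contra : ¬ (∀ l → Spanned I (enum J l))
        contra sp = dependent (λ l → t l ∘ enum I) lt λ (b , (l , b≉0) , r) →
          b≉0 (b≈0 b r l)
          where
          d : Fin ∣ J ∣ → Carrier
          d l = proj₁ (sp l)
          t : Fin ∣ J ∣ → Fin k → Carrier
          t l = proj₁ (proj₂ (proj₂ (sp l)))
          d·v : ∀ l i → d l * v (enum J l) i ≈ sum (λ m → t l (enum I m) * v (enum I m) i)
          d·v l i = trans (proj₂ (proj₂ (proj₂ (sp l))) i) (∑∈-enum I _)

          b≈0 : ∀ b → (∀ m → sum (λ l → b l * t l (enum I m)) ≈ 0#) → ∀ l → b l ≈ 0#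
          b≈0 b r l = cancel (d l) (b l) (proj₁ (proj₂ (sp l))) (begin
            d l * b l    ≈⟨ *-comm _ _ ⟩
            b l * d l    ≈⟨ reflexive (extend-enum J bd 0# l) ⟨
            c̃ (enum J l) ≈⟨ indJ c̃ relation (enum J l) (enum-∈ J l) ⟩
            0#           ∎)
            where
            bd = λ l → b l * d l
            c̃ = extend J bd 0#
            w : Fin ∣ I ∣ → Fin n → Carrier
            w m = v (enum I m)
            relation : ∀ i → ∑∈ J (λ j → c̃ j * v j i) ≈ 0#
            relation i = begin
              ∑∈ J (λ j → c̃ j * v j i)
                ≈⟨ ∑∈-enum J _ ⟩
              sum (λ l → c̃ (enum J l) * v (enum J l) i)
                ≈⟨ ∑-cong (λ l → trans (*-congʳ (reflexive (extend-enum J bd 0# l))) (*-assoc _ _ _)) ⟩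
              sum (λ l → b l * (d l * v (enum J l) i))
                ≈⟨ ∑-cong (λ l → *-congˡ (d·v l i)) ⟩
              sum (λ l → b l * sum (λ m → t l (enum I m) * w m i))
                ≈⟨ ∑-cong (λ l → *-distribˡ-sum (b l) (λ m → t l (enum I m) * w m i)) ⟩
              sum (λ l → sum (λ m → b l * (t l (enum I m) * w m i)))
                ≈⟨ ∑-comm (λ l m → b l * (t l (enum I m) * w m i)) ⟩
              sum (λ m → sum (λ l → b l * (t l (enum I m) * w m i)))
                ≈⟨ ∑-cong {∣ I ∣} (λ m → ∑-cong {∣ J ∣} (λ l → sym (*-assoc _ _ _))) ⟩
              sum (λ m → sum (λ l → (b l * t l (enum I m)) * w m i))
                ≈⟨ ∑-cong (λ m → *-distribʳ-sum (w m i) (λ l → b l * t l (enum I m))) ⟨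
              sum (λ m → sum (λ l → b l * t l (enum I m)) * w m i)
                ≈⟨ ∑-0 (λ m → trans (*-congʳ (r m)) (zeroˡ _)) ⟩
              0# ∎

-- Indices and elements are counted from 0: x : Fin k is the element x + 1 of {1, …, k},
-- so a_i ≤ s_i becomes toℕ (a i) < s i.

ShiftedBasis : ∀ {n k} → (Fin n → ℕ) → Subset k → Set
ShiftedBasis {n} {k} s B = ∃ λ (a : Fin n → Fin k) →
  a Preserves Fin._<_ ⟶ Fin._<_ ×
  (∀ i → toℕ (a i) < s i) ×
  (∀ j → j ∈ B ⇔ ∃ λ i → a i ≡ j)

ShiftedIndependent : ∀ {n k} → (Fin n → ℕ) → Subset k → Set
ShiftedIndependent s I = ∃ λ B → ShiftedBasis s B × I ⊆ B

module ShiftedMatroidProofs where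

  pred< : ∀ {m} → 0 < m → ℕ.pred m < m
  pred< (s≤s _) = ℕ.≤-refl

  pred-mono-< : ∀ {m n} → 0 < m → m < n → ℕ.pred m < ℕ.pred n
  pred-mono-< (s≤s _) (s≤s lt) = lt

  upper lower : ∀ {k} → ℕ → Subset k → Subset k
  upper zero    S       = S
  upper (suc θ) []      = []
  upper (suc θ) (b ∷ S) = outside ∷ upper θ S
  lower zero    S       = ⊥
  lower (suc θ) []      = []
  lower (suc θ) (b ∷ S) = b ∷ lower θ S

  ∈-upper⁺ : ∀ {k} θ {S : Subset k} {x} → x ∈ S → θ ≤ toℕ x → x ∈ upper θ S
  ∈-upper⁺ zero    p         _       = p
  ∈-upper⁺ (suc θ) (there p) (s≤s q) = there (∈-upper⁺ θ p q)

  ∈-upper⁻ : ∀ {k} θ {S : Subset k} {x} → x ∈ upper θ S → x ∈ S × θ ≤ toℕ x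
  ∈-upper⁻ zero    p = p , z≤n
  ∈-upper⁻ (suc θ) {b ∷ S} (there p) = let (q , r) = ∈-upper⁻ θ p in there q , s≤s r

  ∈-lower⁺ : ∀ {k} θ {S : Subset k} {x} → x ∈ S → toℕ x < θ → x ∈ lower θ S
  ∈-lower⁺ (suc θ) here      _       = here
  ∈-lower⁺ (suc θ) (there p) (s≤s q) = there (∈-lower⁺ θ p q)

  ∈-lower⁻ : ∀ {k} θ {S : Subset k} {x} → x ∈ lower θ S → x ∈ S × toℕ x < θ
  ∈-lower⁻ zero    p                  = contradiction p Subset.∉⊥
  ∈-lower⁻ (suc θ) {b ∷ S} here       = here , s≤s z≤n
  ∈-lower⁻ (suc θ) {b ∷ S} (there p)  = let (q , r) = ∈-lower⁻ θ p in there q , s≤s r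

  ∣lower∣+∣upper∣ : ∀ {k} θ (S : Subset k) → ∣ lower θ S ∣ ℕ.+ ∣ upper θ S ∣ ≡ ∣ S ∣
  ∣lower∣+∣upper∣ {k} zero S            = ≡.cong (ℕ._+ ∣ S ∣) (Subset.∣⊥∣≡0 k)
  ∣lower∣+∣upper∣ (suc θ) []            = refl
  ∣lower∣+∣upper∣ (suc θ) (inside  ∷ S) = ≡.cong suc (∣lower∣+∣upper∣ θ S)
  ∣lower∣+∣upper∣ (suc θ) (outside ∷ S) = ∣lower∣+∣upper∣ θ S

  ∣∪⁅⁆∣ : ∀ {k} (S : Subset k) {e} → e ∉ S → ∣ S ∪ ⁅ e ⁆ ∣ ≡ suc ∣ S ∣
  ∣∪⁅⁆∣ (inside  ∷ S) {zero}  e∉S = contradiction here e∉S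
  ∣∪⁅⁆∣ (outside ∷ S) {zero}  e∉S = ≡.cong (suc ∘ ∣_∣) (Subset.∪-identityʳ S)
  ∣∪⁅⁆∣ (inside  ∷ S) {suc e} e∉S = ≡.cong suc (∣∪⁅⁆∣ S (e∉S ∘ there))
  ∣∪⁅⁆∣ (outside ∷ S) {suc e} e∉S = ∣∪⁅⁆∣ S (e∉S ∘ there)

  enum-mono : ∀ {k} (S : Subset k) → enum S Preserves Fin._<_ ⟶ Fin._<_
  enum-mono (inside  ∷ S) {zero}  {suc j} _       = s≤s z≤n
  enum-mono (inside  ∷ S) {suc i} {suc j} (s≤s p) = s≤s (enum-mono S p)
  enum-mono (outside ∷ S) p                       = s≤s (enum-mono S p)

  mono⇒injective : ∀ {m k} {f : Fin m → Fin k} → f Preserves Fin._<_ ⟶ Fin._<_ →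
                   Injective _≡_ _≡_ f
  mono⇒injective {f = f} mono {i} {j} e with Fin.<-cmp i j
  ... | tri< i<j _ _ = contradiction (mono i<j) (Fin.<-irrefl e)
  ... | tri≈ _ i≡j _ = i≡j
  ... | tri> _ _ j<i = contradiction (mono j<i) (Fin.<-irrefl (≡.sym e))

  ∣∣-≤ : ∀ {k m} (S : Subset k) (f : ∀ x → x ∈ S → Fin m) →
         (∀ {x y} (p : x ∈ S) (q : y ∈ S) → f x p ≡ f y q → x ≡ y) → ∣ S ∣ ≤ m
  ∣∣-≤ S f inj = Fin.injective⇒≤ {f = λ i → f (enum S i) (enum-∈ S i)}
    λ e → mono⇒injective (enum-mono S) (inj _ _ e)

  ≤-∣∣ : ∀ {k m} (S : Subset k) (g : Fin m → Fin k) → Injective _≡_ _≡_ g →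
         (∀ i → g i ∈ S) → m ≤ ∣ S ∣
  ≤-∣∣ S g inj g∈S = Fin.injective⇒≤ {f = λ i → proj₁ (enum⁻¹ S (g∈S i))} λ {i} {j} e →
    inj (≡.trans (≡.sym (proj₂ (enum⁻¹ S (g∈S i))))
        (≡.trans (≡.cong (enum S) e) (proj₂ (enum⁻¹ S (g∈S j)))))

  leastDifference : ∀ {k} (I J : Subset k) →
    J ⊆ I ⊎ ∃ λ e → e ∈ J × e ∉ I × ∀ {x} → x ∈ J → x Fin.< e → x ∈ I
  leastDifference [] [] = inj₁ λ ()
  leastDifference (outside ∷ I) (inside ∷ J) = inj₂ (zero , here , (λ ()) , λ _ ())
  leastDifference (inside ∷ I) (c ∷ J) with leastDifference I J
  ... | inj₁ J⊆I = inj₁ λ { here → here ; (there p) → there (J⊆I p) }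
  ... | inj₂ (e , e∈J , e∉I , least) = inj₂ (suc e , there e∈J , e∉I ∘ Subset.drop-there ,
          λ { here _ → here ; (there p) (s≤s lt) → there (least p lt) })
  leastDifference (outside ∷ I) (outside ∷ J) with leastDifference I J
  ... | inj₁ J⊆I = inj₁ λ { (there p) → there (J⊆I p) }
  ... | inj₂ (e , e∈J , e∉I , least) = inj₂ (suc e , there e∈J , e∉I ∘ Subset.drop-there ,
          λ { (there p) (s≤s lt) → there (least p lt) })

  range : ∀ {n k} → (Fin n → Fin k) → Subset k
  range a = tabulate λ j → does (Fin.any? λ i → a i Fin.≟ j)

  ∈-range : ∀ {n k} (a : Fin n → Fin k) j → j ∈ range a ⇔ ∃ λ i → a i ≡ j
  ∈-range a j = mk⇔ to from
    where
    d? = Fin.any? λ i → a i Fin.≟ j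
    l≡ : lookup (range a) j ≡ does d?
    l≡ = Vec.lookup∘tabulate _ j
    to : j ∈ range a → ∃ λ i → a i ≡ j
    to p with d? | ≡.trans (≡.sym l≡) (Vec.[]=⇒lookup p)
    ... | yes q | _ = q
    from : (∃ λ i → a i ≡ j) → j ∈ range a
    from q = Vec.lookup⇒[]= j (range a) (≡.trans l≡ (dec-true d? q))

  module _ {n k} (s : Fin n → ℕ) (s>0 : ∀ i → 0 < s i)
    (s-mono : s Preserves Fin._<_ ⟶ _<_) (s≤k : ∀ i → s i ≤ k) where

    -- Independence is equivalent to: at most n - i elements (1-based) exceed s_i.
    Criterion : Subset k → Set
    Criterion S = ∣ S ∣ ≤ n × ∀ i → ∣ upper (s i) S ∣ ≤ n ∸ suc (toℕ i)

    augment : ∀ {I J} → Criterion I → Criterion J → ∣ I ∣ < ∣ J ∣ →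
              ∃ λ e → e ∈ J × e ∉ I × Criterion (I ∪ ⁅ e ⁆)
    augment {I} {J} (_ , cI) (∣J∣≤n , cJ) lt with leastDifference I J
    ... | inj₁ J⊆I = contradiction (Subset.p⊆q⇒∣p∣≤∣q∣ J⊆I) (ℕ.<⇒≱ lt)
    ... | inj₂ (e , e∈J , e∉I , least) =
      e , e∈J , e∉I , ≡.subst (_≤ n) (≡.sym (∣∪⁅⁆∣ I e∉I)) (ℕ.≤-trans lt ∣J∣≤n) , bound
      where
      open ℕ.≤-Reasoning
      ∈e : ∀ {x} → x ∈ ⁅ e ⁆ → x ≡ e
      ∈e = Subset.x∈⁅y⁆⇒x≡y e
      bound : ∀ i → ∣ upper (s i) (I ∪ ⁅ e ⁆) ∣ ≤ n ∸ suc (toℕ i)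
      bound i with s i ℕ.≤? toℕ e
      ... | no θ≰e = ℕ.≤-trans (Subset.p⊆q⇒∣p∣≤∣q∣ sub) (cI i)
        where
        sub : upper (s i) (I ∪ ⁅ e ⁆) ⊆ upper (s i) I
        sub p = let (q , θ≤x) = ∈-upper⁻ (s i) p in
          [ (λ x∈I → ∈-upper⁺ (s i) x∈I θ≤x)
          , (λ x∈e → contradiction (≡.subst (λ x → s i ≤ toℕ x) (∈e x∈e) θ≤x) θ≰e)
          ]′ (Subset.x∈p∪q⁻ I ⁅ e ⁆ q)
      ... | yes θ≤e = begin
        ∣ upper θ (I ∪ ⁅ e ⁆) ∣  ≤⟨ Subset.p⊆q⇒∣p∣≤∣q∣ sub ⟩
        ∣ upper θ I ∪ ⁅ e ⁆ ∣    ≡⟨ ∣∪⁅⁆∣ (upper θ I) (e∉I ∘ proj₁ ∘ ∈-upper⁻ θ) ⟩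
        suc ∣ upper θ I ∣        ≤⟨ ℕ.≰⇒> more ⟩
        ∣ upper θ J ∣            ≤⟨ cJ i ⟩
        n ∸ suc (toℕ i)          ∎
        where
        θ = s i
        sub : upper θ (I ∪ ⁅ e ⁆) ⊆ upper θ I ∪ ⁅ e ⁆
        sub p = let (q , θ≤x) = ∈-upper⁻ θ p in
          [ (λ x∈I → Subset.x∈p∪q⁺ (inj₁ (∈-upper⁺ θ x∈I θ≤x)))
          , (λ x∈e → Subset.x∈p∪q⁺ (inj₂ x∈e))
          ]′ (Subset.x∈p∪q⁻ I ⁅ e ⁆ q)
        lower⊆ : lower θ J ⊆ lower θ I
        lower⊆ p = let (x∈J , x<θ) = ∈-lower⁻ θ p in
          ∈-lower⁺ θ (least x∈J (ℕ.<-≤-trans x<θ θ≤e)) x<θ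
        more : ¬ (∣ upper θ J ∣ ≤ ∣ upper θ I ∣)
        more le = ℕ.<⇒≱ lt (begin
          ∣ J ∣                               ≡⟨ ∣lower∣+∣upper∣ θ J ⟨
          ∣ lower θ J ∣ ℕ.+ ∣ upper θ J ∣     ≤⟨ ℕ.+-mono-≤ (Subset.p⊆q⇒∣p∣≤∣q∣ lower⊆) le ⟩
          ∣ lower θ I ∣ ℕ.+ ∣ upper θ I ∣     ≡⟨ ∣lower∣+∣upper∣ θ I ⟩
          ∣ I ∣                               ∎)

    independent⇒criterion : ∀ {I} → ShiftedIndependent s I → Criterion I
    independent⇒criterion {I} (B , (a , a-mono , a<s , B≡a) , I⊆B) =
        ∣∣-≤ I (λ x p → proj₁ (index (I⊆B p)))
          (λ p q e → same (proj₂ (index (I⊆B p))) (proj₂ (index (I⊆B q))) e)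
      , λ i → ∣∣-≤ (upper (s i) I)
          (λ x p → fromℕ< (ℕ.∸-monoˡ-< (Fin.toℕ<n (proj₁ (index′ i p))) (later i p)))
          (λ p q e → same (proj₂ (index′ i p)) (proj₂ (index′ i q))
            (Fin.toℕ-injective (ℕ.∸-cancelʳ-≡ (later i p) (later i q)
              (≡.trans (≡.sym (Fin.toℕ-fromℕ< _)) (≡.trans (≡.cong toℕ e) (Fin.toℕ-fromℕ< _))))))
      where
      index : ∀ {x} → x ∈ B → ∃ λ i → a i ≡ x
      index {x} = Equivalence.to (B≡a x)
      index′ : ∀ i {x} → x ∈ upper (s i) I → ∃ λ j → a j ≡ x
      index′ i p = index (I⊆B (proj₁ (∈-upper⁻ (s i) p)))
      same : ∀ {i j x y} → a i ≡ x → a j ≡ y → i ≡ j → x ≡ y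
      same refl refl refl = refl
      later : ∀ i {x} (p : x ∈ upper (s i) I) → suc (toℕ i) ≤ toℕ (proj₁ (index′ i p))
      later i p with index′ i p
      ... | j , refl with Fin.<-cmp i j
      ...   | tri< i<j _ _  = i<j
      ...   | tri≈ _ refl _ = contradiction (proj₂ (∈-upper⁻ (s i) p)) (ℕ.<⇒≱ (a<s i))
      ...   | tri> _ _ j<i  =
        contradiction (proj₂ (∈-upper⁻ (s i) p)) (ℕ.<⇒≱ (ℕ.<-trans (a<s j) (s-mono j<i)))

    -- The basis {s_1, …, s_n}.
    top : Fin n → Fin k
    top i = fromℕ< (ℕ.<-≤-trans (pred< (s>0 i)) (s≤k i))

    toℕ-top : ∀ i → toℕ (top i) ≡ ℕ.pred (s i)
    toℕ-top i = Fin.toℕ-fromℕ< _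

    top-mono : top Preserves Fin._<_ ⟶ Fin._<_
    top-mono {i} {j} i<j = ≡.subst₂ _<_ (≡.sym (toℕ-top i)) (≡.sym (toℕ-top j))
      (pred-mono-< (s>0 i) (s-mono i<j))

    top-basis : ShiftedBasis s (range top)
    top-basis = top , top-mono ,
      (λ i → ≡.subst (_< s i) (≡.sym (toℕ-top i)) (pred< (s>0 i))) ,
      ∈-range top

    grow : ∀ d I → Criterion I → d ℕ.+ ∣ I ∣ ≡ n → ∃ λ B → Criterion B × ∣ B ∣ ≡ n × I ⊆ B
    grow zero    I c e = I , c , e , λ p → p
    grow (suc d) I c e =
      let (x , _ , x∉I , c′)   = augment {I} {range top} c
                                   (independent⇒criterion (range top , top-basis , λ p → p)) lt
          (B , cB , ∣B∣ , sub) = grow d (I ∪ ⁅ x ⁆) c′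
                                   (≡.trans (≡.cong (d ℕ.+_) (∣∪⁅⁆∣ I x∉I)) (≡.trans (ℕ.+-suc d ∣ I ∣) e))
      in B , cB , ∣B∣ , λ p → sub (Subset.p⊆p∪q ⁅ x ⁆ p)
      where
      lt : ∣ I ∣ < ∣ range top ∣
      lt = ℕ.<-≤-trans (≡.subst (∣ I ∣ <_) e (s≤s (ℕ.m≤n+m ∣ I ∣ d)))
             (≤-∣∣ (range top) top (mono⇒injective top-mono)
               λ i → Equivalence.from (∈-range top (top i)) (i , refl))

    full⇒basis : ∀ B → Criterion B → ∣ B ∣ ≡ n → ShiftedBasis s B
    full⇒basis B (_ , cB) refl = a , enum-mono B , a<s ,
      λ j → mk⇔ (enum⁻¹ B) λ { (i , refl) → enum-∈ B i }
      where
      a = enum B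
      a<s : ∀ i → toℕ (a i) < s i
      a<s i with toℕ (a i) ℕ.<? s i
      ... | yes lt = lt
      ... | no ge = contradiction
        (ℕ.≤-trans (≤-∣∣ (upper (s i) B) (a ∘ above) above-inj above∈) (cB i))
        (ℕ.<⇒≱ (ℕ.∸-monoʳ-< (ℕ.n<1+n (toℕ i)) (Fin.toℕ<n i)))
        where
        i+<n : ∀ (l : Fin (n ∸ toℕ i)) → toℕ i ℕ.+ toℕ l < n
        i+<n l = ℕ.<-≤-trans (ℕ.+-monoʳ-< (toℕ i) (Fin.toℕ<n l))
                   (ℕ.≤-reflexive (ℕ.m+[n∸m]≡n (ℕ.<⇒≤ (Fin.toℕ<n i))))
        above : Fin (n ∸ toℕ i) → Fin n
        above l = fromℕ< (i+<n l)
        toℕ-above : ∀ l → toℕ (above l) ≡ toℕ i ℕ.+ toℕ l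
        toℕ-above l = Fin.toℕ-fromℕ< (i+<n l)
        above-inj : Injective _≡_ _≡_ (a ∘ above)
        above-inj {l} {m} e = Fin.toℕ-injective (ℕ.+-cancelˡ-≡ (toℕ i) _ _
          (≡.trans (≡.sym (toℕ-above l))
            (≡.trans (≡.cong toℕ (mono⇒injective (enum-mono B) e)) (toℕ-above m))))
        a-mono-≤ : ∀ {j} → toℕ i ≤ toℕ j → toℕ (a i) ≤ toℕ (a j)
        a-mono-≤ {j} i≤j with Fin.<-cmp i j
        ... | tri< i<j _ _  = ℕ.<⇒≤ (enum-mono B i<j)
        ... | tri≈ _ refl _ = ℕ.≤-refl
        ... | tri> _ _ j<i  = contradiction i≤j (ℕ.<⇒≱ j<i)
        above∈ : ∀ l → a (above l) ∈ upper (s i) B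
        above∈ l = ∈-upper⁺ (s i) (enum-∈ B (above l)) (ℕ.≤-trans (ℕ.≮⇒≥ ge)
          (a-mono-≤ (≡.subst (toℕ i ≤_) (≡.sym (toℕ-above l)) (ℕ.m≤m+n (toℕ i) (toℕ l)))))

    criterion⇒independent : ∀ {I} → Criterion I → ShiftedIndependent s I
    criterion⇒independent {I} c =
      let (B , cB , ∣B∣ , I⊆B) = grow (n ∸ ∣ I ∣) I c (ℕ.m∸n+n≡m (proj₁ c))
      in B , full⇒basis B cB ∣B∣ , I⊆B

    matroid : Matroid k
    matroid = record
      { Independent   = ShiftedIndependent s
      ; ∅-independent = range top , top-basis , Subset.⊥⊆
      ; ⊆-independent = λ I⊆J (B , b , J⊆B) → B , b , λ p → J⊆B (I⊆J p)
      ; augmentation  = λ indI indJ lt ¬aug →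
          let (e , e∈J , e∉I , c) = augment (independent⇒criterion indI) (independent⇒criterion indJ) lt
          in ¬aug (e , e∈J , e∉I , criterion⇒independent c)
      }

    basis-size : ∀ {B : Subset k} → ShiftedBasis s B → ∣ B ∣ ≡ n
    basis-size {B} b@(a , a-mono , _ , B≡a) = ℕ.≤-antisym
      (proj₁ (independent⇒criterion (B , b , Subset.⊆-refl)))
      (≤-∣∣ B a (mono⇒injective a-mono) λ i → Equivalence.from (B≡a (a i)) (i , refl))

    ⊆-basis : ∀ {B B′ : Subset k} → ShiftedBasis s B → ShiftedBasis s B′ → B ⊆ B′ → B′ ⊆ B
    ⊆-basis {B} b b′ B⊆B′ {x} x∈B′ with x Subset.∈? B
    ... | yes x∈B = x∈B
    ... | no  x∉B = contradiction (≡.trans (basis-size b) (≡.sym (basis-size b′)))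
      (ℕ.<⇒≢ (Subset.p⊂q⇒∣p∣<∣q∣ (B⊆B′ , x , x∈B′ , x∉B)))

    basis-independent : ∀ {B : Subset k} → ShiftedBasis s B → ShiftedIndependent s B
    basis-independent {B} b = B , b , Subset.⊆-refl

    bases : ∀ B → Basis matroid B ⇔ ShiftedBasis s B
    bases B = mk⇔ to from
      where
      to : Basis matroid B → ShiftedBasis s B
      to ((B′ , b′ , B⊆B′) , maximal) = ≡.subst (ShiftedBasis s)
        (Subset.⊆-antisym (maximal (basis-independent b′) B⊆B′) B⊆B′) b′
      from : ShiftedBasis s B → Basis matroid B
      from b = basis-independent b , λ (B′ , b′ , J⊆B′) B⊆J x∈J →
        ⊆-basis b b′ (λ p → J⊆B′ (B⊆J p)) (J⊆B′ x∈J)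

open Reals public using (ℝ; 0ℝ; _≈_; ℝ-commutativeRing)
module ℝ-Linear = LinearAlgebra ℝ-commutativeRing
open ℝ-Linear public using (GenericCollection)
module ℝ-Domain = ℝ-Linear.Domain Reals.≈0-stable Reals.≈0-cancel Reals.1≉0

vectorMatroid : ∀ {k n} → (Fin k → Vector ℝ n) → Matroid k
vectorMatroid v = record
  { Independent   = ℝ-Linear.LinearlyIndependent v
  ; ∅-independent = ℝ-Domain.∅-linearlyIndependent v
  ; ⊆-independent = ℝ-Domain.⊆-linearlyIndependent v
  ; augmentation  = ℝ-Domain.augment-linearlyIndependent v
  }

module _ {n-1} (s : Fin (suc n-1) → ℕ)
  (s-positive : ∀ i → 0 < s i) (s-increasing : s Preserves Fin._<_ ⟶ _<_) where

  private
    s≤last : ∀ i → s i ≤ s (fromℕ n-1)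
    s≤last i with Fin.<-cmp i (fromℕ n-1)
    ... | tri< i<l _ _  = ℕ.<⇒≤ (s-increasing i<l)
    ... | tri≈ _ refl _ = ℕ.≤-refl
    ... | tri> _ _ l<i  = contradiction (Fin.≤fromℕ i) (ℕ.<⇒≱ l<i)

  shiftedMatroid : Matroid (s (fromℕ n-1))
  shiftedMatroid = ShiftedMatroidProofs.matroid s s-positive s-increasing s≤last

  shiftedMatroid-bases : ∀ B → Basis shiftedMatroid B ⇔ ShiftedBasis s B
  shiftedMatroid-bases = ShiftedMatroidProofs.bases s s-positive s-increasing s≤last

-- The positions (i , j) with j ≤ s_i (1-based), and the entries of a matrix there.

Staircase : ∀ {n} → (Fin n → ℕ) → ℕ → Set
Staircase {n} s k = Σ (Fin n) λ i → Σ (Fin k) λ j → toℕ j < s i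

staircaseEntries : ∀ {a} {A : Set a} {n k} (s : Fin n → ℕ) →
                   Vector (Vector A k) n → Staircase s k → A
staircaseEntries s M (i , j , _) = M i j

columns : ∀ {a} {A : Set a} {n k} → Vector (Vector A k) n → Fin k → Vector A n
columns = transpose

{-# OPTIONS --safe #-}
module Submission where

-- The isomorphism is the identity.  If S is independent, then the columns of S beyond s_i vanish
-- in the rows up to i, so there are at most n - i of them, which is the counting criterion for
-- independence in the shifted matroid.  Conversely, if S lies in a shifted basis, then S has a
-- transversal through the staircase.  The exterior product of the columns of S has coordinates
-- that are multilinear polynomials with coefficients in {-1, 0, 1} in the generic entries: each
-- column brings new variables, so monomials never collide.  The transversal gives a coordinate
-- with a nonzero polynomial, and genericity makes its value nonzero, whereas every coefficient
-- of a linear relation among the columns annihilates the product.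

open import Defs hiding (_≈_)
open import Algebra.Bundles using (CommutativeRing)
import Algebra.Properties.Ring as RingProperties
import Algebra.Properties.Semiring.Sum as SemiringSum
import Algebra.Solver.Ring.NaturalCoefficients.Default as SemiringSolver
open import Data.Bool.Base using (Bool; true; false; if_then_else_)
open import Data.Fin.Base as Fin using (Fin; zero; suc; toℕ; fromℕ; fromℕ<)
import Data.Fin.Permutation as Permutation
import Data.Fin.Properties as Fin
open import Data.Fin.Subset using (Subset; inside; outside; _∈_; ∣_∣; ⊥)
open import Data.Maybe.Base using (Maybe; just; nothing)
open import Data.Nat.Base as ℕ using (ℕ; zero; suc; _∸_; _≤_; _<_)
import Data.Nat.Properties as ℕ
open import Data.Product.Base using (∃; _×_; _,_; proj₁; proj₂)
open import Data.Sum.Base using (_⊎_; inj₁; inj₂)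
open import Data.Vec.Base using ([]; _∷_; lookup; _[_]≔_)
import Data.Vec.Properties as Vec
open import Data.Vec.Functional using (Vector)
open import Function.Base using (_∘_; id)
open import Function.Bundles using (_⇔_; mk⇔; module Equivalence; module Inverse)
open import Function.Definitions using (Injective)
open import Relation.Binary.Core using (_Preserves_⟶_)
open import Relation.Binary.PropositionalEquality as ≡ using (_≡_; _≢_; refl)
open import Relation.Nullary.Decidable.Core using (yes; no)
open import Relation.Nullary.Negation.Core using (¬_; contradiction)

-- Exterior multiplication over a commutative ring.

module ExteriorAlgebra {c ℓ} (R : CommutativeRing c ℓ) where

  open CommutativeRing R hiding (zero) renaming (refl to ≈-refl)
  open RingProperties ring
  open SemiringSolver commutativeSemiring using (solve; _:=_; _:+_; _:*_)
  open SemiringSum semiring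
  open import Relation.Binary.Reasoning.Setoid setoid

  -- Moves the signs onto `p` and `q`, so that the semiring solver can treat `- p` and `- q` as
  -- atoms.
  neg-linear : ∀ a p q → - (a * p + q) ≈ a * - p - q
  neg-linear a p q = trans (sym (-‿+-comm _ _)) (+-congʳ (-‿distribʳ-* a p))

  -- The coordinate of ω at S is the coefficient of the wedge of the basis vectors in S.
  Λ : ℕ → Set c
  Λ n = Subset n → Carrier

  -- Write `w` as w₀ e₀ + w′ and `ω` as e₀ ∧ α + β, with w′, α and β free of e₀. Then w ∧ ω = e₀ ∧
  -- (w₀ β - w′ ∧ α) + w′ ∧ β; the sign comes from moving w′ past e₀.
  wedge : ∀ {n} → Vector Carrier n → Λ n → Λ n
  wedge w ω []            = 0#
  wedge w ω (outside ∷ T) = wedge (w ∘ suc) (ω ∘ (outside ∷_)) T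
  wedge w ω (inside  ∷ T) = w zero * ω (outside ∷ T) - wedge (w ∘ suc) (ω ∘ (inside ∷_)) T

  wedge-cong : ∀ {n} (w : Vector Carrier n) {ω η : Λ n} → (∀ T → ω T ≈ η T) →
               ∀ T → wedge w ω T ≈ wedge w η T
  wedge-cong w e []            = ≈-refl
  wedge-cong w e (outside ∷ T) = wedge-cong (w ∘ suc) (e ∘ (outside ∷_)) T
  wedge-cong w e (inside  ∷ T) = +-cong (*-congˡ (e (outside ∷ T)))
    (-‿cong (wedge-cong (w ∘ suc) (e ∘ (inside ∷_)) T))

  wedge-neg : ∀ {n} (w : Vector Carrier n) (ω : Λ n) T → wedge w (λ T → - ω T) T ≈ - wedge w ω T
  wedge-neg w ω []            = sym -0#≈0#
  wedge-neg w ω (outside ∷ T) = wedge-neg (w ∘ suc) (ω ∘ (outside ∷_)) T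
  wedge-neg w ω (inside  ∷ T) = begin
    w zero * - x - wedge (w ∘ suc) (λ T → - ω (inside ∷ T)) T
      ≈⟨ +-congˡ (-‿cong (wedge-neg (w ∘ suc) (ω ∘ (inside ∷_)) T)) ⟩
    w zero * - x - - y
      ≈⟨ +-congʳ (-‿distribʳ-* (w zero) x) ⟨
    - (w zero * x) - - y
      ≈⟨ -‿+-comm _ _ ⟩
    - (w zero * x - y) ∎
    where
    x = ω (outside ∷ T)
    y = wedge (w ∘ suc) (ω ∘ (inside ∷_)) T

  -- Additivity and homogeneity are stated as one identity because `sum` unfolds in this shape.
  wedge-linear : ∀ {n} (w : Vector Carrier n) a (ω η : Λ n) T →
                 wedge w (λ T → a * ω T + η T) T ≈ a * wedge w ω T + wedge w η T
  wedge-linear w a ω η []            = sym (trans (+-identityʳ _) (zeroʳ a))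
  wedge-linear w a ω η (outside ∷ T) = wedge-linear (w ∘ suc) a _ _ T
  wedge-linear w a ω η (inside  ∷ T) = begin
    w zero * (a * x + y) - wedge (w ∘ suc) (λ T → a * ω (inside ∷ T) + η (inside ∷ T)) T
      ≈⟨ +-congˡ (-‿cong (wedge-linear (w ∘ suc) a _ _ T)) ⟩
    w zero * (a * x + y) - (a * p + q)
      ≈⟨ +-congˡ (neg-linear a p q) ⟩
    w zero * (a * x + y) + (a * - p - q)
      ≈⟨ solve 6 (λ b a x y p q → b :* (a :* x :+ y) :+ (a :* p :+ q)
                                  := a :* (b :* x :+ p) :+ (b :* y :+ q)) ≈-refl (w zero) a x y (- p) (- q) ⟩
    a * (w zero * x - p) + (w zero * y - q) ∎
    where
    x = ω (outside ∷ T)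
    y = η (outside ∷ T)
    p = wedge (w ∘ suc) (ω ∘ (inside ∷_)) T
    q = wedge (w ∘ suc) (η ∘ (inside ∷_)) T

  wedge-zeroʳ : ∀ {n} (w : Vector Carrier n) {ω : Λ n} → (∀ T → ω T ≈ 0#) → ∀ T → wedge w ω T ≈ 0#
  wedge-zeroʳ w e []            = ≈-refl
  wedge-zeroʳ w e (outside ∷ T) = wedge-zeroʳ (w ∘ suc) (e ∘ (outside ∷_)) T
  wedge-zeroʳ w e (inside  ∷ T) = begin
    w zero * _ - wedge (w ∘ suc) _ T
      ≈⟨ +-cong (trans (*-congˡ (e (outside ∷ T))) (zeroʳ _))
                (trans (-‿cong (wedge-zeroʳ (w ∘ suc) (e ∘ (inside ∷_)) T)) -0#≈0#) ⟩
    0# + 0#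
      ≈⟨ +-identityʳ 0# ⟩
    0# ∎

  wedge-zeroˡ : ∀ {n} {w : Vector Carrier n} (ω : Λ n) → (∀ i → w i ≈ 0#) → ∀ T → wedge w ω T ≈ 0#
  wedge-zeroˡ ω e []            = ≈-refl
  wedge-zeroˡ ω e (outside ∷ T) = wedge-zeroˡ (ω ∘ (outside ∷_)) (e ∘ suc) T
  wedge-zeroˡ {w = w} ω e (inside  ∷ T) = begin
    w zero * _ - wedge (w ∘ suc) _ T
      ≈⟨ +-cong (trans (*-congʳ (e zero)) (zeroˡ _))
                (trans (-‿cong (wedge-zeroˡ (ω ∘ (inside ∷_)) (e ∘ suc) T)) -0#≈0#) ⟩
    0# + 0#
      ≈⟨ +-identityʳ 0# ⟩
    0# ∎

  wedge-linearˡ : ∀ {n} a (v w : Vector Carrier n) (ω : Λ n) T →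
                  wedge (λ i → a * v i + w i) ω T ≈ a * wedge v ω T + wedge w ω T
  wedge-linearˡ a v w ω []            = sym (trans (+-identityʳ _) (zeroʳ a))
  wedge-linearˡ a v w ω (outside ∷ T) = wedge-linearˡ a (v ∘ suc) (w ∘ suc) _ T
  wedge-linearˡ a v w ω (inside  ∷ T) = begin
    (a * v zero + w zero) * x - wedge (λ i → a * v (suc i) + w (suc i)) (ω ∘ (inside ∷_)) T
      ≈⟨ +-congˡ (-‿cong (wedge-linearˡ a (v ∘ suc) (w ∘ suc) _ T)) ⟩
    (a * v zero + w zero) * x - (a * p + q)
      ≈⟨ +-congˡ (neg-linear a p q) ⟩
    (a * v zero + w zero) * x + (a * - p - q)
      ≈⟨ solve 6 (λ a b d x p q → (a :* b :+ d) :* x :+ (a :* p :+ q)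
                                  := a :* (b :* x :+ p) :+ (d :* x :+ q)) ≈-refl a (v zero) (w zero) x (- p) (- q) ⟩
    a * (v zero * x - p) + (w zero * x - q) ∎
    where
    x = ω (outside ∷ T)
    p = wedge (v ∘ suc) (ω ∘ (inside ∷_)) T
    q = wedge (w ∘ suc) (ω ∘ (inside ∷_)) T

  wedge-∑ : ∀ {m n} (w : Vector Carrier n) (a : Vector Carrier m) (ω : Fin m → Λ n) T →
            wedge w (λ T → sum λ j → a j * ω j T) T ≈ sum λ j → a j * wedge w (ω j) T
  wedge-∑ {zero}  w a ω T = wedge-zeroʳ w (λ _ → ≈-refl) T
  wedge-∑ {suc m} w a ω T = trans (wedge-linear w (a zero) (ω zero) _ T)
    (+-congˡ (wedge-∑ w (a ∘ suc) (ω ∘ suc) T))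

  wedge-∑ˡ : ∀ {m n} (a : Vector Carrier m) (w : Fin m → Vector Carrier n) (ω : Λ n) T →
             wedge (λ i → sum λ j → a j * w j i) ω T ≈ sum λ j → a j * wedge (w j) ω T
  wedge-∑ˡ {zero}  a w ω T = wedge-zeroˡ ω (λ _ → ≈-refl) T
  wedge-∑ˡ {suc m} a w ω T = trans (wedge-linearˡ (a zero) (w zero) _ ω T)
    (+-congˡ (wedge-∑ˡ (a ∘ suc) (w ∘ suc) ω T))

  -- The two signs picked up in the `inside` half of `ω` cancel, hence the plus before the last
  -- term, while the bracket is antisymmetric in `u` and `v`. This reduces `wedge-square` and
  -- `wedge-anticomm` to one dimension less.
  wedge-wedge-inside : ∀ {n} (u v : Vector Carrier (suc n)) (ω : Λ (suc n)) T →
    wedge u (wedge v ω) (inside ∷ T) ≈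
    (u zero * wedge (v ∘ suc) (ω ∘ (outside ∷_)) T - v zero * wedge (u ∘ suc) (ω ∘ (outside ∷_)) T)
      + wedge (u ∘ suc) (wedge (v ∘ suc) (ω ∘ (inside ∷_))) T
  wedge-wedge-inside u v ω T = begin
    a - wedge (u ∘ suc) (λ T → v zero * ω (outside ∷ T) - η T) T
      ≈⟨ +-congˡ (-‿cong (wedge-linear (u ∘ suc) (v zero) (ω ∘ (outside ∷_)) (λ T → - η T) T)) ⟩
    a - (b + wedge (u ∘ suc) (λ T → - η T) T)
      ≈⟨ +-congˡ (-‿cong (+-congˡ (wedge-neg (u ∘ suc) η T))) ⟩
    a - (b - y)
      ≈⟨ +-congˡ (-‿+-comm b (- y)) ⟨
    a + (- b - - y)
      ≈⟨ +-congˡ (+-congˡ (-‿involutive y)) ⟩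
    a + (- b + y)
      ≈⟨ +-assoc a (- b) y ⟨
    (a - b) + y ∎
    where
    η = wedge (v ∘ suc) (ω ∘ (inside ∷_))
    a = u zero * wedge (v ∘ suc) (ω ∘ (outside ∷_)) T
    b = v zero * wedge (u ∘ suc) (ω ∘ (outside ∷_)) T
    y = wedge (u ∘ suc) η T

  -- Anticommutation would only give that twice the value is zero, and the ring is arbitrary. So the
  -- square has its own induction, in which the bracket is a difference of equal terms.
  wedge-square : ∀ {n} (w : Vector Carrier n) (ω : Λ n) T → wedge w (wedge w ω) T ≈ 0#
  wedge-square w ω []            = ≈-refl
  wedge-square w ω (outside ∷ T) = wedge-square (w ∘ suc) (ω ∘ (outside ∷_)) T
  wedge-square w ω (inside  ∷ T) = begin
    wedge w (wedge w ω) (inside ∷ T)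
      ≈⟨ wedge-wedge-inside w w ω T ⟩
    (_ - _) + wedge (w ∘ suc) (wedge (w ∘ suc) (ω ∘ (inside ∷_))) T
      ≈⟨ +-cong (-‿inverseʳ _) (wedge-square (w ∘ suc) (ω ∘ (inside ∷_)) T) ⟩
    0# + 0#
      ≈⟨ +-identityʳ 0# ⟩
    0# ∎

  wedge-anticomm : ∀ {n} (u v : Vector Carrier n) (ω : Λ n) T →
                   wedge u (wedge v ω) T ≈ - wedge v (wedge u ω) T
  wedge-anticomm u v ω []            = sym -0#≈0#
  wedge-anticomm u v ω (outside ∷ T) = wedge-anticomm (u ∘ suc) (v ∘ suc) (ω ∘ (outside ∷_)) T
  wedge-anticomm u v ω (inside  ∷ T) = begin
    wedge u (wedge v ω) (inside ∷ T)
      ≈⟨ wedge-wedge-inside u v ω T ⟩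
    (a - b) + wedge (u ∘ suc) (wedge (v ∘ suc) (ω ∘ (inside ∷_))) T
      ≈⟨ +-congˡ (wedge-anticomm (u ∘ suc) (v ∘ suc) (ω ∘ (inside ∷_)) T) ⟩
    (a - b) - y
      ≈⟨ +-congʳ (trans (-‿cong (+-comm b (- a))) (trans (sym (-‿+-comm (- a) b)) (+-congʳ (-‿involutive a)))) ⟨
    - (b - a) - y
      ≈⟨ -‿+-comm (b - a) y ⟩
    - ((b - a) + y)
      ≈⟨ -‿cong (wedge-wedge-inside v u ω T) ⟨
    - wedge v (wedge u ω) (inside ∷ T) ∎
    where
    a = u zero * wedge (v ∘ suc) (ω ∘ (outside ∷_)) T
    b = v zero * wedge (u ∘ suc) (ω ∘ (outside ∷_)) T
    y = wedge (v ∘ suc) (wedge (u ∘ suc) (ω ∘ (inside ∷_))) T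

  -- The head is multiplied first: the result is wₘ ∧ ... ∧ w₁ ∧ ω. With `ω` as an accumulator,
  -- inductions can generalise over it.
  wedges : ∀ {m n} → (Fin m → Vector Carrier n) → Λ n → Λ n
  wedges {zero}  w ω = ω
  wedges {suc m} w ω = wedges (w ∘ suc) (wedge (w zero) ω)

  wedges-cong : ∀ {m n} (w : Fin m → Vector Carrier n) {ω η : Λ n} → (∀ T → ω T ≈ η T) →
                ∀ T → wedges w ω T ≈ wedges w η T
  wedges-cong {zero}  w e = e
  wedges-cong {suc m} w e = wedges-cong (w ∘ suc) (wedge-cong (w zero) e)

  wedges-zero : ∀ {m n} (w : Fin m → Vector Carrier n) {ω : Λ n} → (∀ T → ω T ≈ 0#) →
                ∀ T → wedges w ω T ≈ 0#
  wedges-zero {zero}  w e = e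
  wedges-zero {suc m} w e = wedges-zero (w ∘ suc) (wedge-zeroʳ (w zero) e)

  wedges-neg : ∀ {m n} (w : Fin m → Vector Carrier n) (ω : Λ n) T →
               wedges w (λ T → - ω T) T ≈ - wedges w ω T
  wedges-neg {zero}  w ω T = ≈-refl
  wedges-neg {suc m} w ω T = trans (wedges-cong (w ∘ suc) (wedge-neg (w zero) ω) T)
    (wedges-neg (w ∘ suc) (wedge (w zero) ω) T)

  wedges-∑ : ∀ {l m n} (w : Fin l → Vector Carrier n) (a : Vector Carrier m) (ω : Fin m → Λ n) T →
             wedges w (λ T → sum λ j → a j * ω j T) T ≈ sum λ j → a j * wedges w (ω j) T
  wedges-∑ {zero}  w a ω T = ≈-refl
  wedges-∑ {suc l} w a ω T = trans (wedges-cong (w ∘ suc) (wedge-∑ (w zero) a ω) T)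
    (wedges-∑ (w ∘ suc) a (λ j → wedge (w zero) (ω j)) T)

  -- Anticommutation carries the extra factor outward, up to sign, until it meets its twin, where
  -- `wedge-square` makes the product vanish.
  wedges-repeated : ∀ {m n} (w : Fin m → Vector Carrier n) j (ω : Λ n) T →
                    wedges w (wedge (w j) ω) T ≈ 0#
  wedges-repeated w zero    ω T = wedges-zero (w ∘ suc) (wedge-square (w zero) ω) T
  wedges-repeated w (suc j) ω T = begin
    wedges (w ∘ suc) (wedge (w zero) (wedge (w (suc j)) ω)) T
      ≈⟨ wedges-cong (w ∘ suc) (wedge-anticomm (w zero) (w (suc j)) ω) T ⟩
    wedges (w ∘ suc) (λ T → - wedge (w (suc j)) (wedge (w zero) ω) T) T
      ≈⟨ wedges-neg (w ∘ suc) (wedge (w (suc j)) (wedge (w zero) ω)) T ⟩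
    - wedges (w ∘ suc) (wedge (w (suc j)) (wedge (w zero) ω)) T
      ≈⟨ -‿cong (wedges-repeated (w ∘ suc) j (wedge (w zero) ω) T) ⟩
    - 0#
      ≈⟨ -0#≈0# ⟩
    0# ∎

  private
    ∑-0 : ∀ {m} {f : Vector Carrier m} → (∀ j → f j ≈ 0#) → sum f ≈ 0#
    ∑-0 {m} e = trans (sum-cong-≋ e) (sum-replicate-zero m)

    ∑-neg : ∀ {m} (f : Vector Carrier m) → sum (λ j → - f j) ≈ - sum f
    ∑-neg {zero}  f = sym -0#≈0#
    ∑-neg {suc m} f = trans (+-congˡ (∑-neg (f ∘ suc))) (-‿+-comm _ _)

  -- A form of Cramer's rule. For the first coefficient, multiply the relation by all later vectors.
  -- For a later one, multiply by the first vector, which removes the first term, and absorb that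
  -- vector into `ω`; for this the hypothesis concerns products with `ω`.
  annihilates-wedges : ∀ {m n} (a : Vector Carrier m) (w : Fin m → Vector Carrier n) (ω : Λ n) →
    (∀ T → sum (λ j → a j * wedge (w j) ω T) ≈ 0#) → ∀ j T → a j * wedges w ω T ≈ 0#
  annihilates-wedges a w ω e zero T = begin
    a zero * wedges w ω T
      ≈⟨ +-identityʳ _ ⟨
    a zero * wedges w ω T + 0#
      -- The terms after the first vanish because each contains one vector twice.
      ≈⟨ +-congˡ (∑-0 λ j → trans (*-congˡ (wedges-repeated (w ∘ suc) j ω T)) (zeroʳ _)) ⟨
    sum (λ j → a j * wedges (w ∘ suc) (wedge (w j) ω) T)
      ≈⟨ wedges-∑ (w ∘ suc) a (λ j → wedge (w j) ω) T ⟨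
    wedges (w ∘ suc) (λ T → sum λ j → a j * wedge (w j) ω T) T
      ≈⟨ wedges-zero (w ∘ suc) e T ⟩
    0# ∎
  annihilates-wedges a w ω e (suc j) = annihilates-wedges (a ∘ suc) (w ∘ suc) (wedge (w zero) ω) e′ j
    where
    w₀ = w zero
    e′ : ∀ T → sum (λ j → a (suc j) * wedge (w (suc j)) (wedge w₀ ω) T) ≈ 0#
    e′ T = begin
      sum (λ j → a (suc j) * wedge (w (suc j)) (wedge w₀ ω) T)
        ≈⟨ sum-cong-≋ (λ j → trans (*-congˡ (wedge-anticomm (w (suc j)) w₀ ω T)) (sym (-‿distribʳ-* _ _))) ⟩
      sum (λ j → - (a (suc j) * wedge w₀ (wedge (w (suc j)) ω) T))
        ≈⟨ ∑-neg (λ j → a (suc j) * wedge w₀ (wedge (w (suc j)) ω) T) ⟩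
      - r
        ≈⟨ -‿cong (+-identityˡ r) ⟨
      - (0# + r)
        -- The term of `w₀` itself is a square, hence zero; putting it back completes the given
        -- relation.
        ≈⟨ -‿cong (+-congʳ (trans (*-congˡ (wedge-square w₀ ω T)) (zeroʳ _))) ⟨
      - sum (λ j → a j * wedge w₀ (wedge (w j) ω) T)
        ≈⟨ -‿cong (wedge-∑ w₀ a (λ j → wedge (w j) ω) T) ⟨
      - wedge w₀ (λ T → sum λ j → a j * wedge (w j) ω T) T
        ≈⟨ -‿cong (wedge-zeroʳ w₀ e T) ⟩
      - 0#
        ≈⟨ -0#≈0# ⟩
      0# ∎
      where r = sum λ j → a (suc j) * wedge w₀ (wedge (w (suc j)) ω) T

  relation-annihilates-wedges : ∀ {m n} (a : Vector Carrier m) (w : Fin m → Vector Carrier n) (ω : Λ n) →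
    (∀ i → sum (λ j → a j * w j i) ≈ 0#) → ∀ j T → a j * wedges w ω T ≈ 0#
  relation-annihilates-wedges a w ω e = annihilates-wedges a w ω λ T →
    trans (sym (wedge-∑ˡ a w ω T)) (wedge-zeroˡ ω e T)

-- Multilinear polynomials with coefficients 0, 1 and -1.

data Coefficient : Set where
  −𝟏 𝟎 𝟏 : Coefficient

negate : Coefficient → Coefficient
negate −𝟏 = 𝟏
negate 𝟎  = 𝟎
negate 𝟏  = −𝟏

-- These select the monomials with coefficient 1 and with coefficient -1. A polynomial is the
-- difference of the sums over these two families, and genericity compares exactly such sums.
isPositive isNegative : Coefficient → Bool
isPositive 𝟏  = true
isPositive 𝟎  = false
isPositive −𝟏 = false
isNegative = isPositive ∘ negate

negate≢𝟎 : ∀ {c} → c ≢ 𝟎 → negate c ≢ 𝟎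
negate≢𝟎 {−𝟏} _  ()
negate≢𝟎 {𝟎}  ne _ = ne refl
negate≢𝟎 {𝟏}  _  ()

-- A multilinear polynomial in K variables with coefficients in {-1, 0, 1}: the value at S
-- is the coefficient of the monomial x_S.
Form : ℕ → Set
Form K = Subset K → Coefficient

one : ∀ {K} → Form K
one []            = 𝟏
one (inside  ∷ S) = 𝟎
one (outside ∷ S) = one S

zeroForm : ∀ {K} → Form K
zeroForm _ = 𝟎

-- The polynomial x_e κ + μ, if x_e occurs in neither κ nor μ.
join : ∀ {K} → Fin K → Form K → Form K → Form K
join e κ μ S = if lookup S e then κ (S [ e ]≔ outside) else μ S

NonZero : ∀ {K} → Form K → Set
NonZero κ = ∃ λ S → κ S ≢ 𝟎

-- Freshness of x_e keeps the monomials of x_e κ and μ apart in `join`, so no coefficient leaves the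
-- three allowed values.
Fresh : ∀ {K} → Fin K → Form K → Set
Fresh e κ = ∀ S → lookup S e ≡ inside → κ S ≡ 𝟎

one-fresh : ∀ {K} (e : Fin K) → Fresh e one
one-fresh zero    (inside  ∷ S) _ = refl
one-fresh (suc e) (inside  ∷ S) _ = refl
one-fresh (suc e) (outside ∷ S) p = one-fresh e S p

one-nonZero : ∀ {K} → NonZero (one {K})
one-nonZero {K} = ⊥ , λ e → contradiction (≡.trans (≡.sym (one-⊥ K)) e) λ ()
  where
  one-⊥ : ∀ K → one (⊥ {K}) ≡ 𝟏
  one-⊥ zero    = refl
  one-⊥ (suc K) = one-⊥ K

nonZero⇒outside : ∀ {K} {e : Fin K} {κ} → Fresh e κ → ∀ S → κ S ≢ 𝟎 → lookup S e ≡ outside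
nonZero⇒outside {e = e} fresh S κS≢𝟎 with lookup S e in p
... | outside = refl
... | inside  = contradiction (fresh S p) κS≢𝟎

join-fresh : ∀ {K} {e e′ : Fin K} {κ μ} → e′ ≢ e → Fresh e′ κ → Fresh e′ μ → Fresh e′ (join e κ μ)
join-fresh {e = e} {e′} e′≢e freshκ freshμ S p with lookup S e
... | inside  = freshκ _ (≡.trans (Vec.lookup∘update′ e′≢e S outside) p)
... | outside = freshμ S p

-- The witness is a monomial of `κ` with x_e adjoined. By freshness that monomial lacked x_e, so
-- deleting x_e gives it back.
join-nonZeroˡ : ∀ {K} {e : Fin K} {κ μ} → Fresh e κ → NonZero κ → NonZero (join e κ μ)
join-nonZeroˡ {e = e} {κ} {μ} fresh (S , κS≢𝟎) = S [ e ]≔ inside , κS≢𝟎 ∘ ≡.trans (≡.sym joined)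
  where
  open ≡.≡-Reasoning
  joined : join e κ μ (S [ e ]≔ inside) ≡ κ S
  joined = begin
    join e κ μ (S [ e ]≔ inside)
      ≡⟨ ≡.cong (λ b → if b then κ (S [ e ]≔ inside [ e ]≔ outside) else μ (S [ e ]≔ inside))
                (Vec.lookup∘update e S inside) ⟩
    κ (S [ e ]≔ inside [ e ]≔ outside)
      ≡⟨ ≡.cong κ (Vec.[]≔-idempotent S e) ⟩
    κ (S [ e ]≔ outside)
      ≡⟨ ≡.cong (λ b → κ (S [ e ]≔ b)) (nonZero⇒outside fresh S κS≢𝟎) ⟨
    κ (S [ e ]≔ lookup S e)
      ≡⟨ ≡.cong κ (Vec.[]≔-lookup S e) ⟩
    κ S ∎

join-nonZeroʳ : ∀ {K} {e : Fin K} {κ μ} → Fresh e μ → NonZero μ → NonZero (join e κ μ)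
join-nonZeroʳ {e = e} {κ} {μ} fresh (S , μS≢𝟎) = S , μS≢𝟎 ∘ ≡.trans (≡.sym joined)
  where
  joined : join e κ μ S ≡ μ S
  joined = ≡.cong (λ b → if b then κ (S [ e ]≔ outside) else μ S) (nonZero⇒outside fresh S μS≢𝟎)

-- Formal exterior products of vectors of variables.

-- A vector each of whose coordinates is a variable or 0.
VariableVector : ℕ → ℕ → Set
VariableVector K n = Vector (Maybe (Fin K)) n

multiplyAdd : ∀ {K} → Maybe (Fin K) → Form K → Form K → Form K
multiplyAdd nothing  κ μ = μ
multiplyAdd (just e) κ μ = join e κ μ

-- Follows the clauses of `wedge`, so that evaluation can be compared with it clause by clause.
formalWedge : ∀ {K n} → VariableVector K n → (Subset n → Form K) → Subset n → Form K
formalWedge z Ω []            = zeroForm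
formalWedge z Ω (outside ∷ T) = formalWedge (z ∘ suc) (Ω ∘ (outside ∷_)) T
formalWedge z Ω (inside  ∷ T) = multiplyAdd (z zero) (Ω (outside ∷ T))
  (negate ∘ formalWedge (z ∘ suc) (Ω ∘ (inside ∷_)) T)

formalWedges : ∀ {K m n} → (Fin m → VariableVector K n) → (Subset n → Form K) → Subset n → Form K
formalWedges {m = zero}  z Ω = Ω
formalWedges {m = suc m} z Ω = formalWedges (z ∘ suc) (formalWedge (z zero) Ω)

negate-fresh : ∀ {K} {e : Fin K} {κ} → Fresh e κ → Fresh e (negate ∘ κ)
negate-fresh fresh S p = ≡.cong negate (fresh S p)

multiplyAdd-fresh : ∀ {K} {e : Fin K} y {κ μ} → y ≢ just e → Fresh e κ → Fresh e μ →
                    Fresh e (multiplyAdd y κ μ)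
multiplyAdd-fresh nothing   _  _      freshμ = freshμ
multiplyAdd-fresh (just e′) ne freshκ freshμ = join-fresh (ne ∘ ≡.cong just ∘ ≡.sym) freshκ freshμ

formalWedge-fresh : ∀ {K n} (z : VariableVector K n) {e Ω} → (∀ i → z i ≢ just e) →
                    (∀ T → Fresh e (Ω T)) → ∀ T → Fresh e (formalWedge z Ω T)
formalWedge-fresh z ne fresh []            S _ = refl
formalWedge-fresh z ne fresh (outside ∷ T) =
  formalWedge-fresh (z ∘ suc) (ne ∘ suc) (fresh ∘ (outside ∷_)) T
formalWedge-fresh z ne fresh (inside  ∷ T) = multiplyAdd-fresh (z zero) (ne zero) (fresh (outside ∷ T))
  (negate-fresh (formalWedge-fresh (z ∘ suc) (ne ∘ suc) (fresh ∘ (inside ∷_)) T))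

DistinctVariables : ∀ {K n} → VariableVector K n → Set
DistinctVariables z = ∀ {i j e} → z i ≡ just e → z j ≡ just e → i ≡ j

FreshVariables : ∀ {K n} → VariableVector K n → (Subset n → Form K) → Set
FreshVariables z Ω = ∀ {i e} → z i ≡ just e → ∀ T → Fresh e (Ω T)

private
  tail-distinct : ∀ {K n} {z : VariableVector K (suc n)} → DistinctVariables z →
                  DistinctVariables (z ∘ suc)
  tail-distinct distinct p q = Fin.suc-injective (distinct p q)

  formalWedge-fresh-head : ∀ {K n} (z : VariableVector K (suc n)) {Ω} → DistinctVariables z → FreshVariables z Ω →
    ∀ {e} → z zero ≡ just e → ∀ T → Fresh e (negate ∘ formalWedge (z ∘ suc) (Ω ∘ (inside ∷_)) T)
  formalWedge-fresh-head z {Ω} distinct fresh p T =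
    negate-fresh {κ = formalWedge (z ∘ suc) (Ω ∘ (inside ∷_)) T} (formalWedge-fresh (z ∘ suc)
    (λ i q → contradiction (distinct p q) λ ()) (fresh p ∘ (inside ∷_)) T)

multiplyAdd-nonZeroʳ : ∀ {K} (y : Maybe (Fin K)) {κ μ} → (∀ {e} → y ≡ just e → Fresh e μ) →
                       NonZero μ → NonZero (multiplyAdd y κ μ)
multiplyAdd-nonZeroʳ nothing  _     nz = nz
multiplyAdd-nonZeroʳ (just e) {κ} fresh nz = join-nonZeroʳ {κ = κ} (fresh refl) nz

-- The coefficient at `T` times the variable at `j` contributes to the coordinate with `j` adjoined.
-- The other contributions involve other variables of `z` and cannot cancel it: each `join` on the
-- way keeps both summands intact.
formalWedge-nonZero : ∀ {K n} (z : VariableVector K n) {Ω} → DistinctVariables z → FreshVariables z Ω →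
  ∀ j {e} → z j ≡ just e → ∀ T → lookup T j ≡ outside → NonZero (Ω T) →
  NonZero (formalWedge z Ω (T [ j ]≔ inside))
formalWedge-nonZero z {Ω} distinct fresh zero p (outside ∷ T) refl nz =
  ≡.subst (λ y → NonZero (multiplyAdd y (Ω (outside ∷ T)) (negate ∘ formalWedge (z ∘ suc) (Ω ∘ (inside ∷_)) T)))
    (≡.sym p) (join-nonZeroˡ (fresh p (outside ∷ T)) nz)
formalWedge-nonZero z distinct fresh (suc j) p (outside ∷ T) q nz =
  formalWedge-nonZero (z ∘ suc) (tail-distinct distinct) (λ r T → fresh r (outside ∷ T)) j p T q nz
formalWedge-nonZero z {Ω} distinct fresh (suc j) p (inside  ∷ T) q nz =
  let (S , ne) = formalWedge-nonZero (z ∘ suc) (tail-distinct distinct)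
                   (λ r T → fresh r (inside ∷ T)) j p T q nz
  in multiplyAdd-nonZeroʳ (z zero) {κ = Ω (outside ∷ T [ j ]≔ inside)}
       (λ r → formalWedge-fresh-head z distinct fresh r (T [ j ]≔ inside))
       (S , negate≢𝟎 ne)

JointlyDistinct : ∀ {K m n} → (Fin m → VariableVector K n) → Set
JointlyDistinct z = ∀ {l m i j e} → z l i ≡ just e → z m j ≡ just e → l ≡ m × i ≡ j

private
  tail-jointlyDistinct : ∀ {K m n} {z : Fin (suc m) → VariableVector K n} → JointlyDistinct z →
                         JointlyDistinct (z ∘ suc)
  tail-jointlyDistinct distinct p q =
    let (e , e′) = distinct p q in Fin.suc-injective e , e′

  tail-freshVariables : ∀ {K m n} {z : Fin (suc m) → VariableVector K n} {Ω} → JointlyDistinct z →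
    (∀ l → FreshVariables (z l) Ω) → ∀ l → FreshVariables (z (suc l)) (formalWedge (z zero) Ω)
  tail-freshVariables {z = z} distinct fresh l p T = formalWedge-fresh (z zero)
    (λ i q → contradiction (proj₁ (distinct q p)) λ ()) (fresh (suc l) p) T

-- Each vector adjoins its row `π l` to `T`, starting from a coordinate that avoids all these rows.
-- Injectivity of `π` keeps the later rows outside the enlarged set, and new variables keep the
-- coefficient nonzero.
formalWedges-nonZero : ∀ {K m n} (z : Fin m → VariableVector K n) {Ω} → JointlyDistinct z →
  (∀ l → FreshVariables (z l) Ω) → (π : Fin m → Fin n) → Injective _≡_ _≡_ π →
  (∀ l → ∃ λ e → z l (π l) ≡ just e) → ∀ T → (∀ l → lookup T (π l) ≡ outside) → NonZero (Ω T) →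
  ∃ λ T′ → NonZero (formalWedges z Ω T′)
formalWedges-nonZero {m = zero}  z distinct fresh π inj var T out nz = T , nz
formalWedges-nonZero {m = suc m} z distinct fresh π inj var T out nz =
  formalWedges-nonZero (z ∘ suc) (tail-jointlyDistinct {z = z} distinct) (tail-freshVariables {z = z} distinct fresh)
    (π ∘ suc) (Fin.suc-injective ∘ inj) (var ∘ suc) (T [ π zero ]≔ inside)
    (λ l → ≡.trans (Vec.lookup∘update′ (λ e → contradiction (inj e) λ ()) T inside) (out (suc l)))
    (formalWedge-nonZero (z zero) (λ p q → proj₂ (distinct p q)) (fresh zero)
      (π zero) (proj₂ (var zero)) T (out zero) nz)

-- Evaluation of the polynomials, and genericity.

module Evaluation {c ℓ} (R : CommutativeRing c ℓ) where

  open CommutativeRing R hiding (zero) renaming (refl to ≈-refl)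
  open RingProperties ring
  open SemiringSolver commutativeSemiring using (solve; _:=_; _:+_; _:*_)
  open LinearAlgebra R using (∏∈; ∑⊆; familySum; Generic)
  open ExteriorAlgebra R
  open import Relation.Binary.Reasoning.Setoid setoid

  ⟦_⟧ : Coefficient → Carrier
  ⟦ −𝟏 ⟧ = - 1#
  ⟦ 𝟎 ⟧  = 0#
  ⟦ 𝟏 ⟧  = 1#

  eval : ∀ {K} → Vector Carrier K → Form K → Carrier
  eval {zero}  x κ = ⟦ κ [] ⟧
  eval {suc K} x κ = x zero * eval (x ∘ suc) (κ ∘ (inside ∷_)) + eval (x ∘ suc) (κ ∘ (outside ∷_))

  eval-𝟎 : ∀ {K} (x : Vector Carrier K) {κ : Form K} → (∀ S → κ S ≡ 𝟎) → eval x κ ≈ 0#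
  eval-𝟎 {zero}  x e = reflexive (≡.cong ⟦_⟧ (e []))
  eval-𝟎 {suc K} x e = trans
    (+-cong (trans (*-congˡ (eval-𝟎 (x ∘ suc) (e ∘ (inside ∷_)))) (zeroʳ _)) (eval-𝟎 (x ∘ suc) (e ∘ (outside ∷_))))
    (+-identityʳ 0#)

  eval-one : ∀ {K} (x : Vector Carrier K) → eval x one ≈ 1#
  eval-one {zero}  x = ≈-refl
  eval-one {suc K} x = trans
    (+-cong (trans (*-congˡ (eval-𝟎 (x ∘ suc) (λ _ → refl))) (zeroʳ _)) (eval-one (x ∘ suc)))
    (+-identityˡ 1#)

  eval-negate : ∀ {K} (x : Vector Carrier K) (κ : Form K) → eval x (negate ∘ κ) ≈ - eval x κ
  eval-negate {zero} x κ with κ []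
  ... | −𝟏 = sym (-‿involutive 1#)
  ... | 𝟎  = sym -0#≈0#
  ... | 𝟏  = ≈-refl
  eval-negate {suc K} x κ = trans
    (+-cong (trans (*-congˡ (eval-negate (x ∘ suc) _)) (sym (-‿distribʳ-* _ _))) (eval-negate (x ∘ suc) _))
    (-‿+-comm _ _)

  -- At the variable e, `join` uses only the `outside` halves of `κ` and `μ`; freshness says that
  -- the discarded halves evaluate to zero. The other variables are handled by distributivity.
  eval-join : ∀ {K} (x : Vector Carrier K) e (κ μ : Form K) → Fresh e κ → Fresh e μ →
              eval x (join e κ μ) ≈ x e * eval x κ + eval x μ
  eval-join x zero κ μ freshκ freshμ = sym (+-cong
    (*-congˡ (dropInside κ freshκ)) (dropInside μ freshμ))
    where
    dropInside : ∀ ν → Fresh zero ν → eval x ν ≈ eval (x ∘ suc) (ν ∘ (outside ∷_))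
    dropInside ν fresh = trans
      (+-congʳ (trans (*-congˡ (eval-𝟎 (x ∘ suc) (λ S → fresh (inside ∷ S) refl))) (zeroʳ _)))
      (+-identityˡ _)
  eval-join x (suc e) κ μ freshκ freshμ = begin
    x zero * eval x′ (join e κᵢ μᵢ) + eval x′ (join e κₒ μₒ)
      ≈⟨ +-cong (*-congˡ (eval-join x′ e κᵢ μᵢ (freshκ ∘ (inside ∷_)) (freshμ ∘ (inside ∷_))))
                (eval-join x′ e κₒ μₒ (freshκ ∘ (outside ∷_)) (freshμ ∘ (outside ∷_))) ⟩
    x zero * (x′ e * eval x′ κᵢ + eval x′ μᵢ) + (x′ e * eval x′ κₒ + eval x′ μₒ)
      ≈⟨ solve 6 (λ x y a b c d → x :* (y :* a :+ b) :+ (y :* c :+ d)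
                                  := y :* (x :* a :+ c) :+ (x :* b :+ d)) ≈-refl
           (x zero) (x′ e) (eval x′ κᵢ) (eval x′ μᵢ) (eval x′ κₒ) (eval x′ μₒ) ⟩
    x′ e * (x zero * eval x′ κᵢ + eval x′ κₒ) + (x zero * eval x′ μᵢ + eval x′ μₒ) ∎
    where
    x′ = x ∘ suc
    κᵢ = κ ∘ (inside ∷_)
    κₒ = κ ∘ (outside ∷_)
    μᵢ = μ ∘ (inside ∷_)
    μₒ = μ ∘ (outside ∷_)

  evalVariable : ∀ {K} → Vector Carrier K → Maybe (Fin K) → Carrier
  evalVariable x nothing  = 0#
  evalVariable x (just e) = x e

  eval-multiplyAdd : ∀ {K} (x : Vector Carrier K) y {κ μ : Form K} →
    (∀ {e} → y ≡ just e → Fresh e κ) → (∀ {e} → y ≡ just e → Fresh e μ) →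
    eval x (multiplyAdd y κ μ) ≈ evalVariable x y * eval x κ + eval x μ
  eval-multiplyAdd x nothing  _      _      = sym (trans (+-congʳ (zeroˡ _)) (+-identityˡ _))
  eval-multiplyAdd x (just e) freshκ freshμ = eval-join x e _ _ (freshκ refl) (freshμ refl)

  -- Distinct variables within `z` and their freshness in `Ω` make both summands of an `inside`
  -- coordinate fresh for the head variable, as `eval-multiplyAdd` requires.
  wedge-represented : ∀ {K n} (x : Vector Carrier K) (z : VariableVector K n) (w : Vector Carrier n) {Ω ω} →
    DistinctVariables z → FreshVariables z Ω → (∀ i → w i ≈ evalVariable x (z i)) →
    (∀ T → ω T ≈ eval x (Ω T)) → ∀ T → wedge w ω T ≈ eval x (formalWedge z Ω T)
  wedge-represented x z w distinct fresh w≈ ω≈ [] = sym (eval-𝟎 x λ _ → refl)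
  wedge-represented x z w distinct fresh w≈ ω≈ (outside ∷ T) =
    wedge-represented x (z ∘ suc) (w ∘ suc) (tail-distinct distinct)
      (λ r T → fresh r (outside ∷ T)) (w≈ ∘ suc) (ω≈ ∘ (outside ∷_)) T
  wedge-represented x z w {Ω} {ω} distinct fresh w≈ ω≈ (inside ∷ T) = begin
    w zero * ω (outside ∷ T) - wedge (w ∘ suc) (ω ∘ (inside ∷_)) T
      ≈⟨ +-cong (*-cong (w≈ zero) (ω≈ (outside ∷ T)))
                (-‿cong (wedge-represented x (z ∘ suc) (w ∘ suc) (tail-distinct distinct)
                  (λ r T → fresh r (inside ∷ T)) (w≈ ∘ suc) (ω≈ ∘ (inside ∷_)) T)) ⟩
    evalVariable x (z zero) * eval x (Ω (outside ∷ T)) - eval x μ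
      ≈⟨ +-congˡ (eval-negate x μ) ⟨
    evalVariable x (z zero) * eval x (Ω (outside ∷ T)) + eval x (negate ∘ μ)
      ≈⟨ eval-multiplyAdd x (z zero) (λ p → fresh p (outside ∷ T))
           (λ p → formalWedge-fresh-head z distinct fresh p T) ⟨
    eval x (multiplyAdd (z zero) (Ω (outside ∷ T)) (negate ∘ μ)) ∎
    where μ = formalWedge (z ∘ suc) (Ω ∘ (inside ∷_)) T

  wedges-represented : ∀ {K m n} (x : Vector Carrier K)
    (z : Fin m → VariableVector K n) (w : Fin m → Vector Carrier n) {Ω ω} →
    JointlyDistinct z → (∀ l → FreshVariables (z l) Ω) → (∀ l i → w l i ≈ evalVariable x (z l i)) →
    (∀ T → ω T ≈ eval x (Ω T)) → ∀ T → wedges w ω T ≈ eval x (formalWedges z Ω T)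
  wedges-represented {m = zero}  x z w distinct fresh w≈ ω≈ = ω≈
  wedges-represented {m = suc m} x z w distinct fresh w≈ ω≈ =
    wedges-represented x (z ∘ suc) (w ∘ suc) (tail-jointlyDistinct {z = z} distinct)
      (tail-freshVariables {z = z} distinct fresh) (w≈ ∘ suc)
      (wedge-represented x (z zero) (w zero) (λ p q → proj₂ (distinct p q)) (fresh zero) (w≈ zero) ω≈)

  ∑⊆-cong : ∀ {K} {f g : Subset K → Carrier} → (∀ S → f S ≈ g S) → ∑⊆ f ≈ ∑⊆ g
  ∑⊆-cong {zero}  e = e []
  ∑⊆-cong {suc K} e = +-cong (∑⊆-cong (e ∘ (inside ∷_))) (∑⊆-cong (e ∘ (outside ∷_)))

  ∑⊆-*ˡ : ∀ {K} a (f : Subset K → Carrier) → ∑⊆ (λ S → a * f S) ≈ a * ∑⊆ f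
  ∑⊆-*ˡ {zero}  a f = ≈-refl
  ∑⊆-*ˡ {suc K} a f = trans (+-cong (∑⊆-*ˡ a (f ∘ (inside ∷_))) (∑⊆-*ˡ a (f ∘ (outside ∷_)))) (sym (distribˡ a _ _))

  -- Splitting a family by membership of the first element gives `familySum` the recursion of
  -- `eval`.
  familySum-∷ : ∀ {K} (x : Vector Carrier (suc K)) F →
    familySum x F ≈ x zero * familySum (x ∘ suc) (F ∘ (inside ∷_)) + familySum (x ∘ suc) (F ∘ (outside ∷_))
  familySum-∷ x F = +-cong
    (trans (∑⊆-cong inside≈) (∑⊆-*ˡ (x zero) λ S → if F (inside ∷ S) then ∏∈ S (x ∘ suc) else 0#))
    (∑⊆-cong outside≈)
    where
    inside≈ : ∀ S → (if F (inside ∷ S) then ∏∈ (inside ∷ S) x else 0#) ≈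
                    x zero * (if F (inside ∷ S) then ∏∈ S (x ∘ suc) else 0#)
    inside≈ S with F (inside ∷ S)
    ... | true  = ≈-refl
    ... | false = sym (zeroʳ _)
    outside≈ : ∀ S → (if F (outside ∷ S) then ∏∈ (outside ∷ S) x else 0#) ≈
                     (if F (outside ∷ S) then ∏∈ S (x ∘ suc) else 0#)
    outside≈ S with F (outside ∷ S)
    ... | true  = *-identityˡ _
    ... | false = ≈-refl

  -- The negative family stands on the left instead of being subtracted on the right, so the
  -- inductive step is an identity of commutative semirings.
  eval-families : ∀ {K} (x : Vector Carrier K) (κ : Form K) →
                  eval x κ + familySum x (isNegative ∘ κ) ≈ familySum x (isPositive ∘ κ)
  eval-families {zero} x κ with κ []
  ... | −𝟏 = -‿inverseˡ 1#
  ... | 𝟎  = +-identityʳ 0#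
  ... | 𝟏  = +-identityʳ 1#
  eval-families {suc K} x κ = begin
    (x zero * eval x′ κᵢ + eval x′ κₒ) + familySum x (isNegative ∘ κ)
      ≈⟨ +-congˡ (familySum-∷ x (isNegative ∘ κ)) ⟩
    (x zero * eval x′ κᵢ + eval x′ κₒ) + (x zero * nᵢ + nₒ)
      ≈⟨ solve 5 (λ x a b c d → (x :* a :+ b) :+ (x :* c :+ d)
                                := x :* (a :+ c) :+ (b :+ d)) ≈-refl (x zero) (eval x′ κᵢ) (eval x′ κₒ) nᵢ nₒ ⟩
    x zero * (eval x′ κᵢ + nᵢ) + (eval x′ κₒ + nₒ)
      ≈⟨ +-cong (*-congˡ (eval-families x′ κᵢ)) (eval-families x′ κₒ) ⟩
    x zero * familySum x′ (isPositive ∘ κᵢ) + familySum x′ (isPositive ∘ κₒ)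
      ≈⟨ familySum-∷ x (isPositive ∘ κ) ⟨
    familySum x (isPositive ∘ κ) ∎
    where
    x′ = x ∘ suc
    κᵢ = κ ∘ (inside ∷_)
    κₒ = κ ∘ (outside ∷_)
    nᵢ = familySum x′ (isNegative ∘ κᵢ)
    nₒ = familySum x′ (isNegative ∘ κₒ)

  -- A zero value would equate the sums over the positive and the negative family. These families
  -- differ at any monomial with a nonzero coefficient.
  generic⇒eval≉0 : ∀ {K} {x : Vector Carrier K} → Generic x → ∀ {κ} → NonZero κ → ¬ eval x κ ≈ 0#
  generic⇒eval≉0 {x = x} generic {κ} (S , κS≢𝟎) e =
    generic (isPositive ∘ κ) (isNegative ∘ κ) (S , κS≢𝟎 ∘ signs-agree (κ S)) (begin
      familySum x (isPositive ∘ κ)              ≈⟨ eval-families x κ ⟨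
      eval x κ + familySum x (isNegative ∘ κ)   ≈⟨ +-congʳ e ⟩
      0# + familySum x (isNegative ∘ κ)         ≈⟨ +-identityˡ _ ⟩
      familySum x (isNegative ∘ κ)              ∎)
    where
    signs-agree : ∀ c → isPositive c ≡ isNegative c → c ≡ 𝟎
    signs-agree 𝟎 _ = refl

-- Two tests for linear independence over a domain.

module LinearIndependence {c ℓ} (R : CommutativeRing c ℓ) where

  open CommutativeRing R hiding (zero) renaming (refl to ≈-refl)
  open LinearAlgebra R
  open Enumeration
  open ExteriorAlgebra R using (wedges; relation-annihilates-wedges)
  open Evaluation R
  open SemiringSum semiring using (sum)
  open import Relation.Binary.Reasoning.Setoid setoid

  module OverDomain
    (stable : ∀ x → ¬ ¬ (x ≈ 0#) → x ≈ 0#)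
    (cancel : ∀ x y → ¬ (x ≈ 0#) → x * y ≈ 0# → y ≈ 0#)
    (1≉0    : ¬ (1# ≈ 0#))
    where

    open Domain stable cancel 1≉0

    module _ {k n} (v : Fin k → Vector Carrier n) (S : Subset k) where

      -- Every coefficient of a relation annihilates the product of the vectors, and a nonzero
      -- coordinate of it can be cancelled.
      wedges≉0⇒independent : ∀ ω T → ¬ wedges (v ∘ enum S) ω T ≈ 0# → LinearlyIndependent v S
      wedges≉0⇒independent ω T ≉0 a relation j j∈S with enum⁻¹ S j∈S
      ... | l , refl = cancel _ _ ≉0 (trans (*-comm _ _)
        (relation-annihilates-wedges (a ∘ enum S) (v ∘ enum S) ω
          (λ i → trans (sym (∑∈-enum S _)) (relation i)) l T))

      dependent⇒¬independent : Dependent (v ∘ enum S) → ¬ LinearlyIndependent v S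
      dependent⇒¬independent (a , (l , aₗ≉0) , relation) independent = aₗ≉0 (begin
        a l          ≈⟨ reflexive (extend-enum S a 0# l) ⟨
        b (enum S l) ≈⟨ independent b relation′ (enum S l) (enum-∈ S l) ⟩
        0#           ∎)
        where
        -- The coefficients live on the enumeration of `S`; extension by zero moves them to the
        -- ground set.
        b = extend S a 0#
        relation′ : ∀ i → ∑∈ S (λ j → b j * v j i) ≈ 0#
        relation′ i = begin
          ∑∈ S (λ j → b j * v j i)                    ≈⟨ ∑∈-enum S _ ⟩
          sum (λ l → b (enum S l) * v (enum S l) i)   ≈⟨ ∑-cong (λ l → *-congʳ (reflexive (extend-enum S a 0# l))) ⟩
          sum (λ l → a l * v (enum S l) i)            ≈⟨ relation i ⟩
          0#                                          ∎

      -- More than `m` vectors are dependent on the `m` rows listed by `ρ`, and the relation holds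
      -- trivially in the zero rows. `dependent` is only a double negation, which suffices because
      -- the bound is proved by refuting its opposite.
      independent⇒∣∣≤rows : ∀ {m} (ρ : Fin m → Fin n) →
        (∀ i → (∃ λ l → ρ l ≡ i) ⊎ (∀ j → j ∈ S → v j i ≈ 0#)) →
        LinearlyIndependent v S → ∣ S ∣ ≤ m
      independent⇒∣∣≤rows {m} ρ rows independent = ℕ.≮⇒≥ λ m<∣S∣ →
        dependent (λ l → v (enum S l) ∘ ρ) m<∣S∣ λ (a , a≉0 , relation) →
          dependent⇒¬independent (a , a≉0 , λ i → relation′ a relation i (rows i)) independent
        where
        relation′ : ∀ a → (∀ l → sum (λ j → a j * v (enum S j) (ρ l)) ≈ 0#) → ∀ i →
                    (∃ λ l → ρ l ≡ i) ⊎ (∀ j → j ∈ S → v j i ≈ 0#) →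
                    sum (λ j → a j * v (enum S j) i) ≈ 0#
        relation′ a relation i (inj₁ (l , refl)) = relation l
        relation′ a relation i (inj₂ zeroRow)    =
          ∑-0 λ j → trans (*-congˡ (zeroRow (enum S j) (enum-∈ S j))) (zeroʳ _)

      genericTransversal⇒independent : ∀ {K} {x : Vector Carrier K} → Generic x →
        (z : Fin ∣ S ∣ → VariableVector K n) → JointlyDistinct z →
        (∀ l i → v (enum S l) i ≈ evalVariable x (z l i)) →
        (π : Fin ∣ S ∣ → Fin n) → Injective _≡_ _≡_ π → (∀ l → ∃ λ e → z l (π l) ≡ just e) →
        LinearlyIndependent v S
      genericTransversal⇒independent {x = x} generic z distinct v≈ π π-injective transversal =
        -- The product starts from the element all of whose coordinates are 1: the form `one`
        -- contains no variable, and the empty set is a coordinate outside all rows of the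
        -- transversal.
        let fresh   = λ l {i} {e} _ T → one-fresh e
            (T , nz) = formalWedges-nonZero z {λ _ → one} distinct fresh π π-injective transversal
                         ⊥ (λ l → lookup-⊥ (π l)) one-nonZero
        in wedges≉0⇒independent (λ _ → 1#) T λ e → generic⇒eval≉0 generic nz
             (trans (sym (wedges-represented x z (v ∘ enum S) distinct fresh v≈ (λ _ → sym (eval-one x)) T)) e)
        where
        lookup-⊥ : ∀ (i : Fin n) → lookup ⊥ i ≡ outside
        lookup-⊥ i = Vec.lookup-replicate i outside

-- Matrices supported on a staircase.

open Defs using (_≈_)

private
  module Columns (n-1 : ℕ) (s : Fin (suc n-1) → ℕ)
    (s-positive : ∀ i → 0 < s i) (s-increasing : s Preserves Fin._<_ ⟶ _<_)
    (A : Vector (Vector ℝ (s (fromℕ n-1))) (suc n-1))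
    (zeros : ∀ i j → s i ≤ toℕ j → A i j ≈ 0ℝ) where

    open Enumeration
    open ShiftedMatroidProofs
    open LinearIndependence.OverDomain ℝ-commutativeRing Reals.≈0-stable Reals.≈0-cancel Reals.1≉0
    open ℝ-Linear using (LinearlyIndependent)
    open Evaluation ℝ-commutativeRing using (evalVariable)

    s-mono-≤ : ∀ {i j} → toℕ i ≤ toℕ j → s i ≤ s j
    s-mono-≤ {i} {j} i≤j with ℕ.m≤n⇒m<n∨m≡n i≤j
    ... | inj₁ i<j = ℕ.<⇒≤ (s-increasing i<j)
    ... | inj₂ i≡j = ℕ.≤-reflexive (≡.cong s (Fin.toℕ-injective i≡j))

    s≤last : ∀ i → s i ≤ s (fromℕ n-1)
    s≤last i = s-mono-≤ (Fin.≤fromℕ i)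

    -- All rows together give the bound on the size. As `s` is increasing, a column at 0-based
    -- position `s i` or later vanishes in rows 0 to `i`, so only the rows from `i` + 1 on count for
    -- `upper (s i) I`.
    linearlyIndependent⇒criterion : ∀ {I} → LinearlyIndependent (columns A) I →
                                    Criterion s s-positive s-increasing s≤last I
    linearlyIndependent⇒criterion {I} independent =
      independent⇒∣∣≤rows (columns A) I id (λ i → inj₁ (i , refl)) independent ,
      λ i → independent⇒∣∣≤rows (columns A) (upper (s i) I) (below i) (rows i)
        (ℝ-Domain.⊆-linearlyIndependent (columns A) (proj₁ ∘ ∈-upper⁻ (s i)) independent)
      where
      below< : ∀ i (l : Fin (suc n-1 ∸ suc (toℕ i))) → suc (toℕ i) ℕ.+ toℕ l < suc n-1
      below< i l = ℕ.<-≤-trans (ℕ.+-monoʳ-< (suc (toℕ i)) (Fin.toℕ<n l))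
        (ℕ.≤-reflexive (ℕ.m+[n∸m]≡n (Fin.toℕ<n i)))
      below : ∀ i → Fin (suc n-1 ∸ suc (toℕ i)) → Fin (suc n-1)
      below i l = fromℕ< (below< i l)
      rows : ∀ i r → (∃ λ l → below i l ≡ r) ⊎ (∀ j → j ∈ upper (s i) I → A r j ≈ 0ℝ)
      rows i r with toℕ i ℕ.<? toℕ r
      ... | no  i≮r = inj₂ λ j j∈ →
        zeros r j (ℕ.≤-trans (s-mono-≤ (ℕ.≮⇒≥ i≮r)) (proj₂ (∈-upper⁻ (s i) j∈)))
      ... | yes i<r = inj₁ (fromℕ< r∸i< , Fin.toℕ-injective (begin
        toℕ (below i (fromℕ< r∸i<))                ≡⟨ Fin.toℕ-fromℕ< (below< i _) ⟩
        suc (toℕ i) ℕ.+ toℕ (fromℕ< r∸i<)          ≡⟨ ≡.cong (suc (toℕ i) ℕ.+_) (Fin.toℕ-fromℕ< r∸i<) ⟩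
        suc (toℕ i) ℕ.+ (toℕ r ∸ suc (toℕ i))      ≡⟨ ℕ.m+[n∸m]≡n i<r ⟩
        toℕ r                                      ∎))
        where
        open ≡.≡-Reasoning
        r∸i< : toℕ r ∸ suc (toℕ i) < suc n-1 ∸ suc (toℕ i)
        r∸i< = ℕ.∸-monoˡ-< (Fin.toℕ<n r) i<r

    -- The transversal sends a column of `I` to its index in the increasing listing `a` of the
    -- basis. The bound on `a` places that entry in the staircase, where it is a variable.
    shifted⇒linearlyIndependent : GenericCollection (staircaseEntries s A) →
                                  ∀ {I} → ShiftedIndependent s I → LinearlyIndependent (columns A) I
    shifted⇒linearlyIndependent (K , e , generic) {I} (B , (a , a-mono , a<s , B≡a) , I⊆B) =
      genericTransversal⇒independent (columns A) I generic (λ l i → variableAt i (enum I l))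
        (λ p q → let (i≡j , l≡m) = variable-injective p q in mono⇒injective (enum-mono I) l≡m , i≡j)
        (λ l i → represented i (enum I l)) π π-injective
        (λ l → variable-staircase (π l) (enum I l) (≡.subst (λ j → toℕ j < s (π l)) (a∘π l) (a<s (π l))))
      where
      variableAt : Fin (suc n-1) → Fin (s (fromℕ n-1)) → Maybe (Fin K)
      variableAt i j with toℕ j ℕ.<? s i
      ... | yes j<sᵢ = just (Inverse.from e (i , j , j<sᵢ))
      ... | no  _    = nothing

      -- The listing of the entries is a bijection, so a variable determines its row and column;
      -- this yields joint distinctness.
      variable-position : ∀ i j {y} → variableAt i j ≡ just y →
                          proj₁ (Inverse.to e y) ≡ i × proj₁ (proj₂ (Inverse.to e y)) ≡ j
      variable-position i j p with toℕ j ℕ.<? s i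
      variable-position i j refl | yes j<sᵢ =
        ≡.cong proj₁ to∘from , ≡.cong (proj₁ ∘ proj₂) to∘from
        where to∘from = Inverse.strictlyInverseˡ e (i , j , j<sᵢ)

      variable-injective : ∀ {i i′ j j′ y} → variableAt i j ≡ just y → variableAt i′ j′ ≡ just y →
                           i ≡ i′ × j ≡ j′
      variable-injective p q =
        let (i≡ , j≡) = variable-position _ _ p ; (i′≡ , j′≡) = variable-position _ _ q
        in ≡.trans (≡.sym i≡) i′≡ , ≡.trans (≡.sym j≡) j′≡

      represented : ∀ i j → A i j ≈ evalVariable (staircaseEntries s A ∘ Inverse.to e) (variableAt i j)
      represented i j with toℕ j ℕ.<? s i
      ... | yes j<sᵢ = CommutativeRing.reflexive ℝ-commutativeRing
        (≡.cong (staircaseEntries s A) (≡.sym (Inverse.strictlyInverseˡ e (i , j , j<sᵢ))))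
      ... | no  j≮sᵢ = zeros i j (ℕ.≮⇒≥ j≮sᵢ)

      variable-staircase : ∀ i j → toℕ j < s i → ∃ λ y → variableAt i j ≡ just y
      variable-staircase i j j<sᵢ with toℕ j ℕ.<? s i
      ... | yes _    = _ , refl
      ... | no  j≮sᵢ = contradiction j<sᵢ j≮sᵢ

      index : ∀ l → ∃ λ i → a i ≡ enum I l
      index l = Equivalence.to (B≡a (enum I l)) (I⊆B (enum-∈ I l))
      π : Fin ∣ I ∣ → Fin (suc n-1)
      π = proj₁ ∘ index
      a∘π : ∀ l → a (π l) ≡ enum I l
      a∘π = proj₂ ∘ index
      π-injective : Injective _≡_ _≡_ π
      π-injective {l} {m} e = mono⇒injective (enum-mono I)
        (≡.trans (≡.sym (a∘π l)) (≡.trans (≡.cong a e) (a∘π m)))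

theorem5p2 : (n-1 : ℕ) (s : Fin (suc n-1) → ℕ)
    (s-positive : ∀ i → 0 < s i) (s-increasing : s Preserves Fin._<_ ⟶ _<_)
    (A : Vector (Vector ℝ (s (fromℕ n-1))) (suc n-1)) →
    GenericCollection (staircaseEntries s A) →
    (∀ i j → s i ≤ toℕ j → A i j ≈ 0ℝ) →
    vectorMatroid (columns A) ≅ shiftedMatroid s s-positive s-increasing
theorem5p2 n-1 s s-positive s-increasing A generic zeros = Permutation.id , λ S →
  -- The image of `S` under the identity is `tabulate (lookup S)`, which equals `S` only
  -- propositionally.
  ≡.subst (λ T → Matroid.Independent (vectorMatroid (columns A)) S ⇔ ShiftedIndependent s T)
    (≡.sym (Vec.tabulate∘lookup S))
    (mk⇔ (criterion⇒independent s s-positive s-increasing s≤last ∘ linearlyIndependent⇒criterion)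
         (shifted⇒linearlyIndependent generic))
  where
  open Columns n-1 s s-positive s-increasing A zeros
  open ShiftedMatroidProofs using (criterion⇒independent)
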